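{- For every prime $p\geq 2$, $SD(\mathbb{Q}_p)=\{\mathrm{id}\}$; that is, the only surjective map $f:\mathbb{Q}_p\to\mathbb{Q}_p$ such that $f(x)\neq f(y)$ and $f\left(\frac{x+y}{x-y}\right)=\frac{f(x)+f(y)}{f(x)-f(y)}$ for all $x\neq y$ in $\mathbb{Q}_p$ is the identity map.
   Context: $\mathbb{Q}_p$ denotes the field of $p$-adic numbers (no continuity is assumed on $f$). -}

module Defs where

open import Data.Nat using (ℕ; zero; suc; _∸_; _^_; NonZero)
import Data.Nat
import Data.Fin
open import Data.Nat.Properties using (m^n≢0)
open import Data.Nat.DivMod using (_/_; _mod_)
open import Data.Fin using (Fin)
open import Data.Product using (_×_; _,_)
open import Relation.Binary.PropositionalEquality using () renaming (_≡_ to _≡ℕ_)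

-- The p-adic numbers, for a fixed modulus p (p prime in the theorem).
-- ℤ_p : p-adic integers as digit expansions  a = Σ_{i≥0} a_i p^i , a_i ∈ {0,…,p-1}.
-- ℚ_p : pairs (k , a) denoting p^{-k} · a  (ℚ_p = ℤ_p[1/p]), up to the evident equivalence.

module _ (p : ℕ) .{{_ : NonZero p}} where

  Zp : Set
  Zp = ℕ → Fin p

  trunc : Zp → ℕ → ℕ
  trunc a zero    = 0
  trunc a (suc n) = trunc a n Data.Nat.+ Data.Fin.toℕ (a n) Data.Nat.* p ^ n

  digit : ℕ → ℕ → Fin p
  digit m n = (_/_ m (p ^ n) {{m^n≢0 p n}}) mod p

  _+ᶻ_ : Zp → Zp → Zp
  (a +ᶻ b) n = digit (trunc a (suc n) Data.Nat.+ trunc b (suc n)) n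

  _*ᶻ_ : Zp → Zp → Zp
  (a *ᶻ b) n = digit (trunc a (suc n) Data.Nat.* trunc b (suc n)) n

  -ᶻ_ : Zp → Zp
  (-ᶻ a) n = digit (p ^ suc n ∸ trunc a (suc n)) n

  shift : ℕ → Zp → Zp
  shift zero    a n       = a n
  shift (suc l) a zero    = 0 mod p
  shift (suc l) a (suc n) = shift l a n

  _≈ᶻ_ : Zp → Zp → Set
  a ≈ᶻ b = ∀ n → a n ≡ℕ b n

  -- ℚ_p : (k , a) represents a / p^k
  Qp : Set
  Qp = ℕ × Zp

  _≈_ : Qp → Qp → Set
  (k , a) ≈ (l , b) = shift l a ≈ᶻ shift k b

  _+_ : Qp → Qp → Qp
  (k , a) + (l , b) = (k Data.Nat.+ l , (shift l a +ᶻ shift k b))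

  -_ : Qp → Qp
  - (k , a) = (k , (-ᶻ a))

  _-_ : Qp → Qp → Qp
  x - y = x + (- y)

  _*_ : Qp → Qp → Qp
  (k , a) * (l , b) = (k Data.Nat.+ l , (a *ᶻ b))

  -- division in the field ℚ_p, as a relation:  "z = a / b"  means  z · b = a
  -- (used only with b ≉ 0, where the quotient exists and is unique)
  _≡_/_ : Qp → Qp → Qp → Set
  z ≡ a / b = (z * b) ≈ a

{-# OPTIONS --safe #-}

-- The functional equation gives f 0 = 0, f 1 = 1, f (- x) = - f x and, comparing the pairs (ty , y) and
-- (t , 1), multiplicativity; then f 2 = 2, and by induction f fixes every natural number.
-- If a is integral then 1 + pa has N-th roots for all N ≡ 1 (mod p).  Since f is multiplicative and the
-- N are unbounded, f (1 + pa) is integral, and it follows that f preserves integrality.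
-- Finally, for integral x and a natural number n close to x, t = (x - n) / (x + n) is divisible by a
-- high power of p, hence so are f t and f x - n = f t (f x + n); letting n tend to x gives f x = x.
module Submission where

-- No continuity is assumed, so the topology must be recovered from algebra: integrality has to be
-- detected by powers. If `f y` has a pole, then `f y ^ N` has a pole of order at least `N`, which
-- is impossible when `f y ^ N` is a fixed number and `N` exceeds its pole order. Exponents
-- `N = 1 + k p` serve both needs: `N` is a unit modulo `p`, so Hensel's lemma extracts the roots
-- (for `p = 2` as well), and `N > k`, where `p ^ k` clears the denominator of `f (1 + p a)`.
--
-- The second obstacle is constructive. Equality of p-adic numbers involves infinitely many digits,
-- so neither `x = y` nor `x = 0` can be decided, and a nonzero element need not come with an
-- inverse. Equality is however stable under double negation, so equational goals may use case
-- distinctions and inverses. Integrality of a given fraction, in contrast, is decided by finitely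
-- many digits.

open import Algebra.Bundles using (CommutativeRing)
import Algebra.Properties.AbelianGroup
import Algebra.Properties.CommutativeSemiring.Exp
import Algebra.Properties.Ring
import Algebra.Properties.Semiring.Exp
import Algebra.Properties.Semiring.Mult.TCOptimised
import Algebra.Solver.Ring
open import Algebra.Solver.Ring.AlmostCommutativeRing
  using (fromCommutativeRing; _-Raw-AlmostCommutative⟶_; Induced-equivalence)
open import Data.Empty using (⊥-elim)
open import Data.Fin using (toℕ)
import Data.Fin.Properties as Fin
open import Data.Integer as ℤ using (ℤ; -[1+_]; _⊖_)
import Data.Integer.Properties as ℤ
open import Data.Maybe using (Maybe; just; nothing)
open import Data.Nat as ℕ using (ℕ; zero; suc; NonZero)
open import Data.Nat.Coprimality using (prime⇒coprime; coprime-Bézout)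
open import Data.Nat.DivMod
open import Data.Nat.Divisibility using (n∣m*n)
open import Data.Nat.GCD using (module Bézout)
open import Data.Nat.Primality using (Prime; prime⇒nonTrivial)
import Data.Nat.Properties as ℕ
open import Data.Product using (Σ; _×_; _,_; proj₁; proj₂; ∃)
open import Data.Sum using (_⊎_; inj₁; inj₂)
open import Defs using (Zp; trunc; digit; shift; _+ᶻ_; _*ᶻ_; -ᶻ_; _≈ᶻ_)
open import Level using (0ℓ)
import Relation.Binary.Reasoning.Setoid as SetoidReasoning
open import Relation.Binary.PropositionalEquality as ≡ using (_≡_)
open import Relation.Nullary using (¬_; yes; no)
open import Relation.Nullary.Decidable using (decidable-stable)

open import Algebra.Properties.CommutativeSemigroup ℕ.*-commutativeSemigroup using (x∙yz≈y∙xz)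

-- Ring identities with integer coefficients

module RingTools (R : CommutativeRing 0ℓ 0ℓ) where
  open CommutativeRing R hiding (zero)
  open Algebra.Properties.Ring ring public
    using (-‿involutive; -‿distribˡ-*; -‿distribʳ-*; -0#≈0#)
  open Algebra.Properties.AbelianGroup +-abelianGroup public
    using () renaming (⁻¹-∙-comm to -‿+-comm; x∙y⁻¹≈ε⇒x≈y to x-y≈0⇒x≈y; x≈y⇒x∙y⁻¹≈ε to x≈y⇒x-y≈0)
  open Algebra.Properties.Semiring.Mult.TCOptimised semiring
    using (×-homo-+; ×1-homo-*; 1+×) renaming (_×_ to _·_)
  open Algebra.Properties.Semiring.Exp semiring public
    using (_^_; ^-homo-*; ^-congˡ)
  open Algebra.Properties.CommutativeSemiring.Exp commutativeSemiring public
    using (^-distrib-*)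
  open SetoidReasoning setoid

  -- With the optimised multiple, `nat 0` and `nat 1` reduce to `0#` and `1#`; the solver's numerals
  -- and several base cases rely on it.
  nat : ℕ → Carrier
  nat n = n · 1#

  nat-+ : ∀ m n → nat (m ℕ.+ n) ≈ nat m + nat n
  nat-+ = ×-homo-+ 1#

  nat-* : ∀ m n → nat (m ℕ.* n) ≈ nat m * nat n
  nat-* = ×1-homo-*

  nat-suc : ∀ n → nat (suc n) ≈ 1# + nat n
  nat-suc n = 1+× n 1#

  private
    int : ℤ → Carrier
    int (ℤ.+ n)  = nat n
    int -[1+ n ] = - nat (suc n)

    +-cancel-- : ∀ a b c → (a + b) - (a + c) ≈ b - c
    +-cancel-- a b c = begin
      (a + b) - (a + c)        ≈⟨ +-cong (+-comm a b) (sym (-‿+-comm a c)) ⟩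
      (b + a) + (- a + - c)    ≈⟨ +-assoc b a _ ⟩
      b + (a + (- a + - c))    ≈⟨ +-congˡ (sym (+-assoc a (- a) (- c))) ⟩
      b + ((a - a) + - c)      ≈⟨ +-congˡ (+-congʳ (-‿inverseʳ a)) ⟩
      b + (0# + - c)           ≈⟨ +-congˡ (+-identityˡ _) ⟩
      b - c                    ∎

    int-⊖ : ∀ m n → int (m ⊖ n) ≈ nat m - nat n
    int-⊖ m zero = trans (sym (+-identityʳ _)) (+-congˡ (sym -0#≈0#))
    int-⊖ zero (suc n) = sym (+-identityˡ _)
    int-⊖ (suc m) (suc n) rewrite ℤ.[1+m]⊖[1+n]≡m⊖n m n =
      trans (int-⊖ m n) (trans (sym (+-cancel-- 1# (nat m) (nat n)))
        (+-cong (sym (nat-suc m)) (-‿cong (sym (nat-suc n)))))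

    int-neg : ∀ i → int (ℤ.- i) ≈ - int i
    int-neg (ℤ.+ zero)    = sym -0#≈0#
    int-neg (ℤ.+ (suc n)) = refl
    int-neg -[1+ n ]      = sym (-‿involutive _)

    int-+ : ∀ i j → int (i ℤ.+ j) ≈ int i + int j
    int-+ (ℤ.+ m) (ℤ.+ n) = nat-+ m n
    int-+ (ℤ.+ m) -[1+ n ] = int-⊖ m (suc n)
    int-+ -[1+ m ] (ℤ.+ n) = trans (int-⊖ n (suc m)) (+-comm _ _)
    int-+ -[1+ m ] -[1+ n ] = begin
      - nat (suc (suc (m ℕ.+ n)))       ≡⟨ ≡.cong (λ k → - nat k) (≡.sym (ℕ.+-suc (suc m) n)) ⟩
      - nat (suc m ℕ.+ suc n)           ≈⟨ -‿cong (nat-+ (suc m) (suc n)) ⟩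
      - (nat (suc m) + nat (suc n))     ≈⟨ sym (-‿+-comm _ _) ⟩
      - nat (suc m) + - nat (suc n)     ∎

    int-*-+ : ∀ m j → int (ℤ.+ m ℤ.* j) ≈ nat m * int j
    int-*-+ m (ℤ.+ n) rewrite ≡.sym (ℤ.pos-* m n) = nat-* m n
    int-*-+ m -[1+ n ] = begin
      int (ℤ.+ m ℤ.* ℤ.- ℤ.+ suc n)    ≡⟨ ≡.cong int (≡.sym (ℤ.neg-distribʳ-* (ℤ.+ m) (ℤ.+ suc n))) ⟩
      int (ℤ.- (ℤ.+ m ℤ.* ℤ.+ suc n))  ≈⟨ int-neg (ℤ.+ m ℤ.* ℤ.+ suc n) ⟩
      - int (ℤ.+ m ℤ.* ℤ.+ suc n)      ≈⟨ -‿cong (int-*-+ m (ℤ.+ suc n)) ⟩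
      - (nat m * nat (suc n))          ≈⟨ -‿distribʳ-* _ _ ⟩
      nat m * - nat (suc n)            ∎

    int-* : ∀ i j → int (i ℤ.* j) ≈ int i * int j
    int-* (ℤ.+ m) j = int-*-+ m j
    int-* -[1+ m ] j = begin
      int (ℤ.- ℤ.+ suc m ℤ.* j)     ≡⟨ ≡.cong int (≡.sym (ℤ.neg-distribˡ-* (ℤ.+ suc m) j)) ⟩
      int (ℤ.- (ℤ.+ suc m ℤ.* j))   ≈⟨ int-neg (ℤ.+ suc m ℤ.* j) ⟩
      - int (ℤ.+ suc m ℤ.* j)       ≈⟨ -‿cong (int-*-+ (suc m) j) ⟩
      - (nat (suc m) * int j)       ≈⟨ -‿distribˡ-* _ _ ⟩
      - nat (suc m) * int j         ∎

    -- Coefficients are integers because their equality is decidable, which lets the solver cancel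
    -- terms over a ring whose own equality is not.
    morphism : CommutativeRing.rawRing ℤ.+-*-commutativeRing -Raw-AlmostCommutative⟶ fromCommutativeRing R
    morphism = record
      { ⟦_⟧ = int ; +-homo = int-+ ; *-homo = int-* ; -‿homo = int-neg
      ; 0-homo = refl ; 1-homo = refl }

    int≟ : ∀ i j → Maybe (Induced-equivalence morphism i j)
    int≟ i j with i ℤ.≟ j
    ... | yes ≡.refl = just refl
    ... | no _       = nothing

  open Algebra.Solver.Ring (CommutativeRing.rawRing ℤ.+-*-commutativeRing)
    (fromCommutativeRing R) morphism int≟ public
    using (solve; _:=_; _:+_; _:*_; _:-_; :-_; con; Polynomial)

  :nat : ∀ {k} → ℕ → Polynomial k
  :nat n = con (ℤ.+ n)

  -- To derive x ≈ y from l ≈ r, exhibit x - y as a multiple of l - r: what is left is a ring identity.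
  lc : ∀ {x y l r} c → l ≈ r → x ≈ y + c * (l - r) → x ≈ y
  lc {x} {y} {l} {r} c l≈r eq = begin
    x               ≈⟨ eq ⟩
    y + c * (l - r) ≈⟨ +-congˡ (*-congˡ (x≈y⇒x-y≈0 l≈r)) ⟩
    y + c * 0#      ≈⟨ +-congˡ (zeroʳ c) ⟩
    y + 0#          ≈⟨ +-identityʳ y ⟩
    y               ∎

  lc₂ : ∀ {x y l r l′ r′} c c′ → l ≈ r → l′ ≈ r′ → x ≈ (y + c * (l - r)) + c′ * (l′ - r′) → x ≈ y
  lc₂ c c′ e e′ eq = lc c e (lc c′ e′ eq)

-- The ring of p-adic integers

-- Polynomials are kept as syntax so that preservation of congruence modulo `p ^ k`, needed for
-- fixed points, follows by induction on the expression.
data Poly (A : Set) : Set where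
  var     : Poly A
  const   : A → Poly A
  _⊕_ _⊗_ : Poly A → Poly A → Poly A

module Evaluation (R : CommutativeRing 0ℓ 0ℓ) where
  open CommutativeRing R

  eval : Poly Carrier → Carrier → Carrier
  eval var       z = z
  eval (const c) z = c
  eval (P ⊕ Q)   z = eval P z + eval Q z
  eval (P ⊗ Q)   z = eval P z * eval Q z

module PAdicIntegers (p : ℕ) .{{_ : NonZero p}} where
  open import Data.Nat using (_+_; _*_; _∸_; _^_; _<_; _≤_; s≤s; z≤n)
  open ≡ using (refl; sym; trans; cong; cong₂; module ≡-Reasoning)

  Z : Set
  Z = Zp p

  tr : Z → ℕ → ℕ
  tr = trunc p

  infix 4 _≋_
  _≋_ : Z → Z → Set
  _≋_ = _≈ᶻ_ p

  -- Arithmetic modulo powers of p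

  red : ℕ → ℕ → ℕ
  red n x = _%_ x (p ^ n) {{ℕ.m^n≢0 p n}}

  red-red : ∀ n x → red n (red n x) ≡ red n x
  red-red n x = m%n%n≡m%n x (p ^ n) {{ℕ.m^n≢0 p n}}

  red-+ : ∀ n {x x′ y y′} → red n x ≡ red n x′ → red n y ≡ red n y′ → red n (x + y) ≡ red n (x′ + y′)
  red-+ n {x} {x′} {y} {y′} ex ey = begin
    red n (x + y)             ≡⟨ %-distribˡ-+ x y (p ^ n) ⟩
    red n (red n x + red n y) ≡⟨ cong₂ (λ u v → red n (u + v)) ex ey ⟩
    red n (red n x′ + red n y′) ≡⟨ %-distribˡ-+ x′ y′ (p ^ n) ⟨
    red n (x′ + y′)           ∎
    where
    open ≡-Reasoning
    instance _ = ℕ.m^n≢0 p n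

  red-* : ∀ n {x x′ y y′} → red n x ≡ red n x′ → red n y ≡ red n y′ → red n (x * y) ≡ red n (x′ * y′)
  red-* n {x} {x′} {y} {y′} ex ey = begin
    red n (x * y)             ≡⟨ %-distribˡ-* x y (p ^ n) ⟩
    red n (red n x * red n y) ≡⟨ cong₂ (λ u v → red n (u * v)) ex ey ⟩
    red n (red n x′ * red n y′) ≡⟨ %-distribˡ-* x′ y′ (p ^ n) ⟨
    red n (x′ * y′)           ∎
    where
    open ≡-Reasoning
    instance _ = ℕ.m^n≢0 p n

  red-multiple : ∀ n x k → red n (x + k * p ^ n) ≡ red n x
  red-multiple n x k = [m+kn]%n≡m%n x k (p ^ n) {{ℕ.m^n≢0 p n}}

  red-p^n : ∀ n → red n (p ^ n) ≡ red n 0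
  red-p^n n = trans (cong (red n) (sym (ℕ.+-identityʳ (p ^ n)))) (red-multiple n 0 1)

  red-cancelʳ : ∀ n {x y} a → a ≤ p ^ n → red n (x + a) ≡ red n (y + a) → red n x ≡ red n y
  red-cancelʳ n {x} {y} a a≤ e = trans (sym (back x)) (trans (red-+ n e refl) (back y))
    where
    open ≡-Reasoning
    back : ∀ x → red n (x + a + (p ^ n ∸ a)) ≡ red n x
    back x = begin
      red n (x + a + (p ^ n ∸ a))   ≡⟨ cong (red n) (trans (ℕ.+-assoc x a _) (cong (x +_) (ℕ.m+[n∸m]≡n a≤))) ⟩
      red n (x + p ^ n)             ≡⟨ cong (λ q → red n (x + q)) (sym (ℕ.+-identityʳ (p ^ n))) ⟩
      red n (x + 1 * p ^ n)         ≡⟨ red-multiple n x 1 ⟩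
      red n x                       ∎

  -- The link between digits and residues: `(x % p ^ suc n) / p ^ n` equals `(x / p ^ n) % p`.
  red-suc : ∀ n x → red (suc n) x ≡ red n x + toℕ (digit p x n) * p ^ n
  red-suc n x = begin
    y                                       ≡⟨ m≡m%n+[m/n]*n y (p ^ n) ⟩
    y % p ^ n + y / p ^ n * p ^ n           ≡⟨ cong₂ (λ u v → u + v * p ^ n)
                                                 (m∣n⇒o%n%m≡o%m (p ^ n) (p * p ^ n) x (n∣m*n p))
                                                 (trans (m%[n*o]/o≡m/o%n x p (p ^ n)) (sym (Fin.toℕ-fromℕ< _))) ⟩
    red n x + toℕ (digit p x n) * p ^ n     ∎
    where
    open ≡-Reasoning
    instance _ = ℕ.m^n≢0 p n
    instance _ = ℕ.m^n≢0 p (suc n)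
    y = red (suc n) x

  trunc< : ∀ a n → tr a n < p ^ n
  trunc< a zero    = s≤s z≤n
  trunc< a (suc n) = begin-strict
    tr a n + toℕ (a n) * p ^ n   <⟨ ℕ.+-monoˡ-< (toℕ (a n) * p ^ n) (trunc< a n) ⟩
    suc (toℕ (a n)) * p ^ n      ≤⟨ ℕ.*-monoˡ-≤ (p ^ n) (Fin.toℕ<n (a n)) ⟩
    p * p ^ n                    ∎
    where open ℕ.≤-Reasoning

  red-trunc : ∀ a n → red n (tr a n) ≡ tr a n
  red-trunc a n = m<n⇒m%n≡m {{ℕ.m^n≢0 p n}} (trunc< a n)

  trunc-coherent : ∀ a n → red n (tr a (suc n)) ≡ red n (tr a n)
  trunc-coherent a n = red-multiple n (tr a n) (toℕ (a n))

  trunc-cong : ∀ {a b} → a ≋ b → ∀ n → tr a n ≡ tr b n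
  trunc-cong e zero    = refl
  trunc-cong e (suc n) = cong₂ (λ u d → u + toℕ d * p ^ n) (trunc-cong e n) (e n)

  trunc-injective : ∀ {a b} → (∀ n → tr a n ≡ tr b n) → a ≋ b
  trunc-injective {a} {b} e n = Fin.toℕ-injective (ℕ.*-cancelʳ-≡ _ _ (p ^ n) {{ℕ.m^n≢0 p n}}
    (ℕ.+-cancelˡ-≡ (tr a n) _ _ (trans (e (suc n)) (cong (_+ toℕ (b n) * p ^ n) (sym (e n))))))

  -- A point of the inverse limit of the rings of integers modulo `p ^ n`; the representatives `X n`
  -- need not be reduced.
  Coherent : (ℕ → ℕ) → Set
  Coherent X = ∀ n → red n (X (suc n)) ≡ red n (X n)

  -- Digit `n` is visible only modulo `p ^ suc n`, hence the index `suc n`. In this form sum,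
  -- product and negation of `Zp` are limits by definition.
  limit : (ℕ → ℕ) → Z
  limit X n = digit p (X (suc n)) n

  trunc-limit : ∀ X → Coherent X → ∀ n → tr (limit X) n ≡ red n (X n)
  trunc-limit X coh zero    = sym (n%1≡0 (X 0))
  trunc-limit X coh (suc n) = begin
    tr (limit X) n + toℕ (digit p (X (suc n)) n) * p ^ n    ≡⟨ cong (_+ toℕ (digit p (X (suc n)) n) * p ^ n) (trunc-limit X coh n) ⟩
    red n (X n) + toℕ (digit p (X (suc n)) n) * p ^ n       ≡⟨ cong (_+ toℕ (digit p (X (suc n)) n) * p ^ n) (coh n) ⟨
    red n (X (suc n)) + toℕ (digit p (X (suc n)) n) * p ^ n ≡⟨ red-suc n (X (suc n)) ⟨
    red (suc n) (X (suc n))                                 ∎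
    where open ≡-Reasoning

  infix 4 _▹_
  -- Representing p-adic integers by sequences of naturals reduces the ring axioms, through
  -- `▹-unique`, to identities in ℕ at each level.
  _▹_ : Z → (ℕ → ℕ) → Set
  a ▹ X = ∀ n → red n (tr a n) ≡ red n (X n)

  ▹-trunc : ∀ a → a ▹ tr a
  ▹-trunc a n = refl

  ▹-unique : ∀ {a b X Y} → a ▹ X → b ▹ Y → (∀ n → red n (X n) ≡ red n (Y n)) → a ≋ b
  ▹-unique {a} {b} aX bY e = trunc-injective λ n →
    trans (sym (red-trunc a n)) (trans (aX n) (trans (e n) (trans (sym (bY n)) (red-trunc b n))))

  ▹-limit : ∀ {X} → Coherent X → limit X ▹ X
  ▹-limit {X} coh n = trans (cong (red n) (trunc-limit X coh n)) (red-red n (X n))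

  infixl 6 _⊞_
  infixl 7 _⊠_
  _⊞_ _⊠_ : Z → Z → Z
  _⊞_ = _+ᶻ_ p
  _⊠_ = _*ᶻ_ p

  ⊟_ : Z → Z
  ⊟_ = -ᶻ_ p

  ι : ℕ → Z
  ι m = limit λ _ → m

  trunc-ι : ∀ m n → tr (ι m) n ≡ red n m
  trunc-ι m = trunc-limit (λ _ → m) λ n → refl

  ι▹ : ∀ m → ι m ▹ λ _ → m
  ι▹ m = ▹-limit λ n → refl

  +-coherent : ∀ a b → Coherent λ n → tr a n + tr b n
  +-coherent a b n = red-+ n (trunc-coherent a n) (trunc-coherent b n)

  *-coherent : ∀ a b → Coherent λ n → tr a n * tr b n
  *-coherent a b n = red-* n (trunc-coherent a n) (trunc-coherent b n)

  +▹ : ∀ {a b X Y} → a ▹ X → b ▹ Y → (a ⊞ b) ▹ λ n → X n + Y n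
  +▹ {a} {b} aX bY n = trans (▹-limit (+-coherent a b) n) (red-+ n (aX n) (bY n))

  *▹ : ∀ {a b X Y} → a ▹ X → b ▹ Y → (a ⊠ b) ▹ λ n → X n * Y n
  *▹ {a} {b} aX bY n = trans (▹-limit (*-coherent a b) n) (red-* n (aX n) (bY n))

  neg-cancel : ∀ a n → p ^ n ∸ tr a n + tr a n ≡ p ^ n
  neg-cancel a n = ℕ.m∸n+n≡m (ℕ.<⇒≤ (trunc< a n))

  -- Stated for the truncations themselves, unlike `+▹` and `*▹`: they lie below `p ^ n`, so the
  -- subtraction is exact.
  -▹ : ∀ a → (⊟ a) ▹ λ n → p ^ n ∸ tr a n
  -▹ a = ▹-limit λ n → red-cancelʳ n (tr a n) (ℕ.<⇒≤ (trunc< a n)) (begin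
    red n (p ^ suc n ∸ tr a (suc n) + tr a n)        ≡⟨ red-+ n {p ^ suc n ∸ tr a (suc n)} refl (sym (trunc-coherent a n)) ⟩
    red n (p ^ suc n ∸ tr a (suc n) + tr a (suc n))  ≡⟨ cong (red n) (neg-cancel a (suc n)) ⟩
    red n (p * p ^ n)                                ≡⟨ red-multiple n 0 p ⟩
    red n 0                                          ≡⟨ red-p^n n ⟨
    red n (p ^ n)                                    ≡⟨ cong (red n) (neg-cancel a n) ⟨
    red n (p ^ n ∸ tr a n + tr a n)                  ∎)
    where open ≡-Reasoning

  -- Agreement of the first `n` digits suffices: the operations do not increase p-adic distance,
  -- which is what contraction arguments use.
  trunc-+-cong : ∀ {a a′ b b′} n → tr a n ≡ tr a′ n → tr b n ≡ tr b′ n → tr (a ⊞ b) n ≡ tr (a′ ⊞ b′) n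
  trunc-+-cong {a} {a′} {b} {b′} n ea eb = trans (trunc-limit _ (+-coherent a b) n)
    (trans (cong₂ (λ u v → red n (u + v)) ea eb) (sym (trunc-limit _ (+-coherent a′ b′) n)))

  trunc-*-cong : ∀ {a a′ b b′} n → tr a n ≡ tr a′ n → tr b n ≡ tr b′ n → tr (a ⊠ b) n ≡ tr (a′ ⊠ b′) n
  trunc-*-cong {a} {a′} {b} {b′} n ea eb = trans (trunc-limit _ (*-coherent a b) n)
    (trans (cong₂ (λ u v → red n (u * v)) ea eb) (sym (trunc-limit _ (*-coherent a′ b′) n)))

  private
    r : ∀ a → a ▹ tr a
    r = ▹-trunc

    +-comm : ∀ a b → (a ⊞ b) ≋ (b ⊞ a)
    +-comm a b = ▹-unique (+▹ (r a) (r b)) (+▹ (r b) (r a)) λ n → cong (red n) (ℕ.+-comm (tr a n) (tr b n))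

    *-comm : ∀ a b → (a ⊠ b) ≋ (b ⊠ a)
    *-comm a b = ▹-unique (*▹ (r a) (r b)) (*▹ (r b) (r a)) λ n → cong (red n) (ℕ.*-comm (tr a n) (tr b n))

    +-identityˡ : ∀ a → (ι 0 ⊞ a) ≋ a
    +-identityˡ a = ▹-unique (+▹ (ι▹ 0) (r a)) (r a) λ n → refl

    *-identityˡ : ∀ a → (ι 1 ⊠ a) ≋ a
    *-identityˡ a = ▹-unique (*▹ (ι▹ 1) (r a)) (r a) λ n → cong (red n) (ℕ.*-identityˡ (tr a n))

    -‿inverseˡ : ∀ a → (⊟ a ⊞ a) ≋ ι 0
    -‿inverseˡ a = ▹-unique (+▹ (-▹ a) (r a)) (ι▹ 0) λ n → trans (cong (red n) (neg-cancel a n)) (red-p^n n)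

    distribʳ : ∀ a b c → ((b ⊞ c) ⊠ a) ≋ (b ⊠ a ⊞ c ⊠ a)
    distribʳ a b c = ▹-unique (*▹ (+▹ (r b) (r c)) (r a)) (+▹ (*▹ (r b) (r a)) (*▹ (r c) (r a)))
      λ n → cong (red n) (ℕ.*-distribʳ-+ (tr a n) (tr b n) (tr c n))

    ≋-trans : ∀ {a b c} → a ≋ b → b ≋ c → a ≋ c
    ≋-trans e e′ n = trans (e n) (e′ n)

    +-cong : ∀ {a a′ b b′} → a ≋ a′ → b ≋ b′ → (a ⊞ b) ≋ (a′ ⊞ b′)
    +-cong ea eb = trunc-injective λ n → trunc-+-cong n (trunc-cong ea n) (trunc-cong eb n)

    *-cong : ∀ {a a′ b b′} → a ≋ a′ → b ≋ b′ → (a ⊠ b) ≋ (a′ ⊠ b′)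
    *-cong ea eb = trunc-injective λ n → trunc-*-cong n (trunc-cong ea n) (trunc-cong eb n)

  commutativeRing : CommutativeRing 0ℓ 0ℓ
  commutativeRing = record
    { Carrier = Z ; _≈_ = _≋_ ; _+_ = _⊞_ ; _*_ = _⊠_ ; -_ = ⊟_ ; 0# = ι 0 ; 1# = ι 1
    ; isCommutativeRing = record
      { isRing = record
        { +-isAbelianGroup = record
          { isGroup = record
            { isMonoid = record
              { isSemigroup = record
                { isMagma = record
                  { isEquivalence = record
                    { refl = λ n → refl ; sym = λ e n → sym (e n) ; trans = ≋-trans }
                  ; ∙-cong = +-cong }
                ; assoc = λ a b c → ▹-unique (+▹ (+▹ (r a) (r b)) (r c)) (+▹ (r a) (+▹ (r b) (r c)))
                            λ n → cong (red n) (ℕ.+-assoc (tr a n) (tr b n) (tr c n)) }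
              ; identity = +-identityˡ , λ a → ≋-trans (+-comm a (ι 0)) (+-identityˡ a) }
            ; inverse = -‿inverseˡ , λ a → ≋-trans (+-comm a (⊟ a)) (-‿inverseˡ a)
            ; ⁻¹-cong = λ {a} {b} e → ▹-unique (-▹ a) (-▹ b)
                          λ n → cong (λ u → red n (p ^ n ∸ u)) (trunc-cong e n) }
          ; comm = +-comm }
        ; *-cong = *-cong
        ; *-assoc = λ a b c → ▹-unique (*▹ (*▹ (r a) (r b)) (r c)) (*▹ (r a) (*▹ (r b) (r c)))
                      λ n → cong (red n) (ℕ.*-assoc (tr a n) (tr b n) (tr c n))
        ; *-identity = *-identityˡ , λ a → ≋-trans (*-comm a (ι 1)) (*-identityˡ a)
        ; distrib = (λ a b c → ≋-trans (*-comm a (b ⊞ c)) (≋-trans (distribʳ a b c)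
                      (+-cong (*-comm b a) (*-comm c a)))) , distribʳ }
      ; *-comm = *-comm } }

  -- Multiplication by p as a shift of digits

  module R = CommutativeRing commutativeRing
  open RingTools commutativeRing using (nat; nat-suc) renaming (_^_ to _^ᴿ_)
  open Evaluation commutativeRing

  π : Z
  π = nat p

  ι≈nat : ∀ m → ι m ≋ nat m
  ι≈nat zero    = R.refl
  ι≈nat (suc m) = R.trans
    (▹-unique (ι▹ (suc m)) (+▹ (ι▹ 1) (ι▹ m)) λ n → refl)
    (R.trans (R.+-congˡ {ι 1} (ι≈nat m)) (R.sym (nat-suc m)))

  trunc-shift : ∀ a n → tr (shift p 1 a) (suc n) ≡ p * tr a n
  trunc-shift a zero    = trans (trans (ℕ.*-identityʳ _) (trans (Fin.toℕ-fromℕ< _) (m*n%n≡0 0 p))) (sym (ℕ.*-zeroʳ p))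
  trunc-shift a (suc n) = begin
    tr (shift p 1 a) (suc n) + toℕ (a n) * (p * p ^ n)   ≡⟨ cong₂ _+_ (trunc-shift a n) (x∙yz≈y∙xz (toℕ (a n)) p (p ^ n)) ⟩
    p * tr a n + p * (toℕ (a n) * p ^ n)                 ≡⟨ ℕ.*-distribˡ-+ p (tr a n) _ ⟨
    p * tr a (suc n)                                     ∎
    where
    open ≡-Reasoning

  shift▹ : ∀ a → shift p 1 a ▹ λ n → p * tr a n
  shift▹ a zero    = trans (n%1≡0 (tr (shift p 1 a) 0)) (sym (n%1≡0 (p * 0)))
  shift▹ a (suc n) = begin
    red (suc n) (tr (shift p 1 a) (suc n))               ≡⟨ cong (red (suc n)) (trunc-shift a n) ⟩
    red (suc n) (p * tr a n)                             ≡⟨ red-multiple (suc n) _ (toℕ (a n)) ⟨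
    red (suc n) (p * tr a n + toℕ (a n) * (p * p ^ n))   ≡⟨ cong (λ u → red (suc n) (u + toℕ (a n) * (p * p ^ n))) (trunc-shift a n) ⟨
    red (suc n) (tr (shift p 1 a) (suc (suc n)))         ≡⟨ cong (red (suc n)) (trunc-shift a (suc n)) ⟩
    red (suc n) (p * tr a (suc n))                       ∎
    where open ≡-Reasoning

  shift-π : ∀ a → shift p 1 a ≋ (π ⊠ a)
  shift-π a = R.trans
    (▹-unique (shift▹ a) (*▹ (ι▹ p) (▹-trunc a)) λ n → refl)
    (R.*-congʳ {a} (ι≈nat p))

  shift-π^ : ∀ l a → shift p l a ≋ (π ^ᴿ l ⊠ a)
  shift-π^ zero    a = R.sym (R.*-identityˡ a)
  shift-π^ (suc l) a = R.trans {j = shift p 1 (shift p l a)} (λ { zero → refl ; (suc n) → refl })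
    (R.trans (shift-π (shift p l a))
      (R.trans (R.*-congˡ {π} (shift-π^ l a)) (R.sym (R.*-assoc π (π ^ᴿ l) a))))

  trunc-π : ∀ a n → tr (π ⊠ a) (suc n) ≡ p * tr a n
  trunc-π a n = trans (sym (trunc-cong (shift-π a) (suc n))) (trunc-shift a n)

  -- Multiplication by `π` moves digit `n` to place `suc n`, where it can be read off.
  π-cancel : ∀ {a b} → (π ⊠ a) ≋ (π ⊠ b) → a ≋ b
  π-cancel {a} {b} e n = R.trans (shift-π a) (R.trans e (R.sym (shift-π b))) (suc n)

  -- Each single digit has decidable equality.
  stable : ∀ {a b} → ¬ ¬ (a ≋ b) → a ≋ b
  stable {a} {b} nn n = decidable-stable (a n Fin.≟ b n) λ ne → nn λ e → ne (e n)

  separated : ∀ a → (∀ k → ∃ λ b → a ≋ (π ^ᴿ k ⊠ b)) → a ≋ ι 0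
  separated a h = ▹-unique (▹-trunc a) (ι▹ 0) λ n → cong (red n)
    (trans (trunc-cong (proj₂ (h n)) n) (vanish (proj₁ (h n)) n))
    where
    vanish : ∀ b n → tr (π ^ᴿ n ⊠ b) n ≡ 0
    vanish b zero    = refl
    vanish b (suc n) = trans (trunc-cong (R.*-assoc π (π ^ᴿ n) b) (suc n))
      (trans (trunc-π (π ^ᴿ n ⊠ b) n) (trans (cong (p *_) (vanish b n)) (ℕ.*-zeroʳ p)))

  trunc-tail : ∀ a n → tr a (suc n) ≡ toℕ (a 0) + p * tr (λ i → a (suc i)) n
  trunc-tail a zero    = trans (ℕ.*-identityʳ _) (sym (trans (cong (toℕ (a 0) +_) (ℕ.*-zeroʳ p)) (ℕ.+-identityʳ _)))
  trunc-tail a (suc n) = begin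
    tr a (suc n) + d * (p * p ^ n)            ≡⟨ cong₂ _+_ (trunc-tail a n) (x∙yz≈y∙xz d p (p ^ n)) ⟩
    toℕ (a 0) + p * t + p * (d * p ^ n)       ≡⟨ ℕ.+-assoc (toℕ (a 0)) _ _ ⟩
    toℕ (a 0) + (p * t + p * (d * p ^ n))     ≡⟨ cong (toℕ (a 0) +_) (ℕ.*-distribˡ-+ p t _) ⟨
    toℕ (a 0) + p * (t + d * p ^ n)           ∎
    where
    open ≡-Reasoning
    d = toℕ (a (suc n))
    t = tr (λ i → a (suc i)) n

  residue : ∀ a → a ≋ (nat (toℕ (a 0)) ⊞ π ⊠ (λ i → a (suc i)))
  residue a = R.trans
    (▹-unique (▹-trunc a) (+▹ (ι▹ (toℕ (a 0))) (*▹ (ι▹ p) (▹-trunc a′)))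
      λ n → trans (sym (trunc-coherent a n)) (cong (red n) (trunc-tail a n)))
    (R.+-cong (ι≈nat (toℕ (a 0))) (R.*-congʳ {a′} (ι≈nat p)))
    where
    a′ : Z
    a′ i = a (suc i)

  module Nontrivial (1<p : 1 < p) where

    n<p^n : ∀ n → n < p ^ n
    n<p^n zero    = s≤s z≤n
    n<p^n (suc n) = ℕ.≤-trans (s≤s (n<p^n n)) (ℕ.≤-trans
      (ℕ.m<m+n (p ^ n) (ℕ.≤-trans (s≤s z≤n) (n<p^n n)))
      (ℕ.≤-trans (ℕ.≤-reflexive (cong (p ^ n +_) (sym (ℕ.+-identityʳ (p ^ n))))) (ℕ.*-monoˡ-≤ (p ^ n) 1<p)))

    -- Since `suc n < p ^ suc n`, the number `suc n` is its own residue at level `suc n`.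
    nat≉0 : ∀ n → ¬ (nat (suc n) ≋ ι 0)
    nat≉0 n e = ℕ.1+n≢0 (begin
      suc n                            ≡⟨ m<n⇒m%n≡m {{ℕ.m^n≢0 p (suc n)}} (n<p^n (suc n)) ⟨
      red (suc n) (suc n)              ≡⟨ trunc-ι (suc n) (suc n) ⟨
      tr (ι (suc n)) (suc n)           ≡⟨ trunc-cong (R.trans (ι≈nat (suc n)) e) (suc n) ⟩
      tr (ι 0) (suc n)                 ≡⟨ trunc-ι 0 (suc n) ⟩
      red (suc n) 0                    ≡⟨ m<n⇒m%n≡m {{ℕ.m^n≢0 p (suc n)}} (ℕ.≤-trans (s≤s z≤n) (n<p^n (suc n))) ⟩
      0                                ∎)
      where open ≡-Reasoning

    π-nonunit : ∀ s → ¬ ((π ⊠ s) ≋ ι 1)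
    π-nonunit s e = ℕ.1+n≢0 (begin
      1                   ≡⟨ m<n⇒m%n≡m {{ℕ.m^n≢0 p 1}} (n<p^n 1) ⟨
      red 1 1             ≡⟨ trunc-ι 1 1 ⟨
      tr (ι 1) 1          ≡⟨ trunc-cong e 1 ⟨
      tr (π ⊠ s) 1        ≡⟨ trunc-π s 0 ⟩
      p * 0               ≡⟨ ℕ.*-zeroʳ p ⟩
      0                   ∎)
      where open ≡-Reasoning

  -- Banach's fixed point theorem: each application of `T` settles one more digit, so digit `n` is
  -- final in the iterate number `suc n`.
  contraction-fixpoint : (T : Z → Z) → (∀ y y′ k → tr y k ≡ tr y′ k → tr (T y) (suc k) ≡ tr (T y′) (suc k)) →
                         ∃ λ z → z ≋ T z
  contraction-fixpoint T contr = z , trunc-injective λ where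
      zero    → refl
      (suc n) → trans (trunc-z (suc n)) (contr (iter n) z n (sym (trunc-z n)))
    where
    iter : ℕ → Z
    iter zero    = ι 0
    iter (suc n) = T (iter n)
    stabilises : ∀ n → tr (iter n) n ≡ tr (iter (suc n)) n
    stabilises zero    = refl
    stabilises (suc n) = contr (iter n) (iter (suc n)) n (stabilises n)
    z : Z
    z n = iter (suc n) n
    trunc-z : ∀ n → tr z n ≡ tr (iter n) n
    trunc-z zero    = refl
    trunc-z (suc n) = cong (_+ toℕ (z n) * p ^ n) (trans (trunc-z n) (stabilises n))

  -- Hensel's lemma in the form used here; the factor `π` makes the right-hand side a contraction.
  fixpoint : ∀ P b → ∃ λ z → z ≋ (b ⊞ π ⊠ eval P z)
  fixpoint P b = contraction-fixpoint (λ z → b ⊞ π ⊠ eval P z) λ y y′ k e →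
    trunc-+-cong {b} {b} {π ⊠ eval P y} {π ⊠ eval P y′} (suc k) refl
      (trans (trunc-π (eval P y) k) (trans (cong (p *_) (eval-cong P y y′ k e)) (sym (trunc-π (eval P y′) k))))
    where
    eval-cong : ∀ P y y′ k → tr y k ≡ tr y′ k → tr (eval P y) k ≡ tr (eval P y′) k
    eval-cong var       y y′ k e = e
    eval-cong (const c) y y′ k e = refl
    eval-cong (P ⊕ Q)   y y′ k e = trunc-+-cong k (eval-cong P y y′ k e) (eval-cong Q y y′ k e)
    eval-cong (P ⊗ Q)   y y′ k e = trunc-*-cong k (eval-cong P y y′ k e) (eval-cong Q y y′ k e)

-- Henselian valued fields

-- Equality is not decidable, so field inverses are available only under a double negation
-- (FieldProperties.inverse); stability of ≈ makes this sufficient.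
record HenselianField (p : ℕ) : Set₁ where
  field
    commutativeRing : CommutativeRing 0ℓ 0ℓ
  open CommutativeRing commutativeRing public hiding (zero)
  open RingTools commutativeRing public
  π : Carrier
  π = nat p
  field
    stable    : ∀ {x y} → ¬ ¬ x ≈ y → x ≈ y
    nat≉0     : ∀ n → ¬ nat (suc n) ≈ 0#
    π⁻¹       : Carrier
    π*π⁻¹≈1   : π * π⁻¹ ≈ 1#
    Int       : Carrier → Set
    Int-resp  : ∀ {x y} → x ≈ y → Int x → Int y
    Int-1     : Int 1#
    Int-+     : ∀ {x y} → Int x → Int y → Int (x + y)
    Int-*     : ∀ {x y} → Int x → Int y → Int (x * y)
    Int-neg   : ∀ {x} → Int x → Int (- x)
    π-nonunit : ∀ {s} → Int s → ¬ π * s ≈ 1#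
    -- Either `x` lies in the valuation ring or its inverse lies in the maximal ideal.
    valuation : ∀ x → Int x ⊎ ∃ λ s → Int s × x * (π * s) ≈ 1#
    bounded   : ∀ x → ∃ λ k → Int (π ^ k * x)
    separated : ∀ x → (∀ k → ∃ λ s → Int s × x ≈ π ^ k * s) → x ≈ 0#
    residue   : ∀ {x} → Int x → ∃ λ n → ∃ λ s → Int s × x ≈ nat n + π * s
    root      : ∀ {x} → Int x → ∀ k → ∃ λ y → y ^ suc (k ℕ.* p) ≈ 1# + π * x

module FieldProperties {p : ℕ} (F : HenselianField p) where
  open HenselianField F
  open SetoidReasoning setoid

  -- Excluded middle is available when the goal is stable.
  by-cases : ∀ {x y a b} → (x ≈ y → a ≈ b) → (¬ x ≈ y → a ≈ b) → a ≈ b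
  by-cases eq neq = stable λ a≉b → a≉b (neq λ x≈y → a≉b (eq x≈y))

  1≉0 : ¬ 1# ≈ 0#
  1≉0 = nat≉0 0

  ^-inverse : ∀ k → π ^ k * π⁻¹ ^ k ≈ 1#
  ^-inverse zero    = *-identityˡ 1#
  ^-inverse (suc k) = lc₂ (π ^ k * π⁻¹ ^ k) 1# π*π⁻¹≈1 (^-inverse k)
    (solve 4 (λ a b u v → (a :* u) :* (b :* v) :=
        (:nat 1 :+ (u :* v) :* (a :* b :- :nat 1)) :+ :nat 1 :* (u :* v :- :nat 1))
      refl π π⁻¹ (π ^ k) (π⁻¹ ^ k))

  -- For each `k`, `valuation` either shows that `π ^ k` divides `x` or produces an inverse of `x`.
  -- Without an inverse, `x` is divisible by every `π ^ k`, hence zero.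
  inverse : ∀ {x} → ¬ x ≈ 0# → ¬ ¬ (∃ λ i → x * i ≈ 1#)
  inverse {x} x≉0 none = x≉0 (separated x divisible)
    where
    divisible : ∀ k → ∃ λ s → Int s × x ≈ π ^ k * s
    divisible k with valuation (π⁻¹ ^ k * x)
    ... | inj₁ int = π⁻¹ ^ k * x , int , lc (- x) (^-inverse k)
          (solve 3 (λ x a b → x := a :* (b :* x) :+ (:- x) :* (a :* b :- :nat 1)) refl x (π ^ k) (π⁻¹ ^ k))
    ... | inj₂ (s , _ , eq) = ⊥-elim (none (π⁻¹ ^ k * (π * s) ,
            trans (solve 4 (λ x a b c → x :* (a :* (b :* c)) := (a :* x) :* (b :* c)) refl x (π⁻¹ ^ k) π s) eq))

  *-cancelˡ : ∀ {x a b} → ¬ x ≈ 0# → x * a ≈ x * b → a ≈ b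
  *-cancelˡ {x} {a} {b} x≉0 xa≈xb = stable λ a≉b → inverse x≉0 λ (i , xi≈1) →
    a≉b (lc₂ i (b - a) xa≈xb xi≈1
      (solve 4 (λ x a b i → a := (b :+ i :* (x :* a :- x :* b)) :+ (b :- a) :* (x :* i :- :nat 1)) refl x a b i))

  *-≉0 : ∀ {x y} → ¬ x ≈ 0# → ¬ y ≈ 0# → ¬ x * y ≈ 0#
  *-≉0 x≉0 y≉0 xy≈0 = y≉0 (*-cancelˡ x≉0 (trans xy≈0 (sym (zeroʳ _))))

  x-y≉0 : ∀ {x y} → ¬ x ≈ y → ¬ x - y ≈ 0#
  x-y≉0 x≉y x-y≈0 = x≉y (x-y≈0⇒x≈y _ _ x-y≈0)

  unit≉0 : ∀ {x i} → x * i ≈ 1# → ¬ x ≈ 0#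
  unit≉0 {x} {i} xi≈1 x≈0 = 1≉0 (trans (sym xi≈1) (trans (*-congʳ x≈0) (zeroˡ i)))

  Int-nat : ∀ n → Int (nat n)
  Int-nat zero    = Int-resp (-‿inverseʳ 1#) (Int-+ Int-1 (Int-neg Int-1))
  Int-nat (suc n) = Int-resp (sym (nat-suc n)) (Int-+ Int-1 (Int-nat n))

  Int-π : Int π
  Int-π = Int-nat p

  Int-^ : ∀ {x} n → Int x → Int (x ^ n)
  Int-^ zero    _   = Int-1
  Int-^ (suc n) int = Int-* int (Int-^ n int)

  approximate : ∀ {x} → Int x → ∀ k → ∃ λ n → ∃ λ s → Int s × x ≈ nat n + π ^ k * s
  approximate {x} int zero = 0 , x , int , solve 1 (λ x → x := :nat 0 :+ :nat 1 :* x) refl x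
  approximate {x} int (suc k) with residue int
  ... | n , s , ints , x≈ with approximate ints k
  ...   | m , t , intt , s≈ = n ℕ.+ p ℕ.* m , t , intt , (begin
    x                                      ≈⟨ x≈ ⟩
    nat n + π * s                          ≈⟨ +-congˡ (*-congˡ s≈) ⟩
    nat n + π * (nat m + π ^ k * t)        ≈⟨ solve 5 (λ n π m q t → n :+ π :* (m :+ q :* t) :=
                                                (n :+ π :* m) :+ (π :* q) :* t) refl (nat n) π (nat m) (π ^ k) t ⟩
    (nat n + π * nat m) + π ^ suc k * t    ≈⟨ +-congʳ (sym (trans (nat-+ n _) (+-congˡ (nat-* p m)))) ⟩
    nat (n ℕ.+ p ℕ.* m) + π ^ suc k * t    ∎)

  -- Apply `valuation` to `(1 + π x) / π`. If it were integral, `π` would divide 1; otherwise its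
  -- inverse is `π s` with `s` the inverse sought.
  principal-unit : ∀ {x} → Int x → ∃ λ y → Int y × (1# + π * x) * y ≈ 1#
  principal-unit {x} int with valuation (π⁻¹ * (1# + π * x))
  ... | inj₂ (s , ints , eq) = s , ints , lc₂ (- ((1# + π * x) * s)) 1# π*π⁻¹≈1 eq
          (solve 4 (λ p q s e → e :* s := (:nat 1 :+ (:- (e :* s)) :* (p :* q :- :nat 1))
              :+ :nat 1 :* ((q :* e) :* (p :* s) :- :nat 1))
            refl π π⁻¹ s (1# + π * x))
  ... | inj₁ int′ = ⊥-elim (π-nonunit (Int-+ int′ (Int-neg int)) (lc (1# + π * x) π*π⁻¹≈1
          (solve 3 (λ p q x → p :* (q :* (:nat 1 :+ p :* x) :+ :- x) :=
              :nat 1 :+ (:nat 1 :+ p :* x) :* (p :* q :- :nat 1)) refl π π⁻¹ x)))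


-- Maps respecting the quotient (x + y) / (x - y)

record QuotientMap {p : ℕ} (F : HenselianField p) : Set where
  open HenselianField F
  field
    f      : Carrier → Carrier
    f-cong : ∀ {x y} → x ≈ y → f x ≈ f y
    f-inj  : ∀ {x y} → ¬ x ≈ y → ¬ f x ≈ f y
    f-quot : ∀ x y z w → ¬ x ≈ y → z * (x - y) ≈ x + y → w * (f x - f y) ≈ f x + f y → f z ≈ w

module QuotientMapProperties {p : ℕ} {F : HenselianField p} (φ : QuotientMap F) where
  open HenselianField F
  open QuotientMap φ
  open FieldProperties F
  open SetoidReasoning setoid

  -- Replaces the relational quotient `w` by an equation. An inverse of `f x - f y` exists only
  -- under a double negation, which the stable goal absorbs.
  f-eqn : ∀ {x y z} → ¬ x ≈ y → z * (x - y) ≈ x + y → f z * (f x - f y) ≈ f x + f y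
  f-eqn {x} {y} {z} x≉y z≈ = stable λ ne → inverse (x-y≉0 (f-inj x≉y)) λ (i , eq) →
    let w = (f x + f y) * i
        w≈ : w * (f x - f y) ≈ f x + f y
        w≈ = lc (f x + f y) eq
          (solve 3 (λ s d i → (s :* i) :* d := s :+ s :* (d :* i :- :nat 1)) refl (f x + f y) (f x - f y) i)
    in ne (trans (*-congʳ (f-quot x y z w x≉y z≈ w≈)) w≈)

  private
    1≉2 : ¬ nat 1 ≈ nat 2
    1≉2 e = 1≉0 (lc (- 1#) e (solve 0 (:nat 1 := :nat 0 :+ :- :nat 1 :* (:nat 1 :- :nat 2)) refl))

    2≉0 : ¬ nat 2 ≈ 0#
    2≉0 = nat≉0 1

    f-eqn-0 : ∀ {x} → ¬ x ≈ 0# → f 1# * (f x - f 0#) ≈ f x + f 0#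
    f-eqn-0 {x} x≉0 = f-eqn x≉0 (solve 1 (λ x → :nat 1 :* (x :- :nat 0) := x :+ :nat 0) refl x)

  -- The pairs (1 , 0) and (2 , 0) both have quotient 1. Subtracting their equations leaves
  -- `f 1 * (f 1 - f 2) = f 1 - f 2`, and `f 1` differs from `f 2`.
  f1≈1 : f 1# ≈ 1#
  f1≈1 = *-cancelˡ (x-y≉0 (f-inj 1≉2)) (lc₂ 1# (- 1#) (f-eqn-0 1≉0) (f-eqn-0 2≉0)
    (solve 3 (λ a b o → (a :- b) :* a := ((a :- b) :* :nat 1 :+ :nat 1 :* (a :* (a :- o) :- (a :+ o)))
        :+ (:- :nat 1) :* (a :* (b :- o) :- (b :+ o)))
      refl (f 1#) (f (nat 2)) (f 0#)))

  f0≈0 : f 0# ≈ 0#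
  f0≈0 = *-cancelˡ 2≉0 (lc₂ (- 1#) (f 1# - f 0#) (f-eqn-0 1≉0) f1≈1
    (solve 2 (λ a o → :nat 2 :* o := (:nat 2 :* :nat 0 :+ (:- :nat 1) :* (a :* (a :- o) :- (a :+ o)))
        :+ (a :- o) :* (a :- :nat 1)) refl (f 1#) (f 0#)))

  f≉0 : ∀ {x} → ¬ x ≈ 0# → ¬ f x ≈ 0#
  f≉0 x≉0 fx≈0 = f-inj x≉0 (trans fx≈0 (sym f0≈0))

  -- For `x` nonzero, the pair (x , - x) has quotient 0, and `f 0 = 0`.
  f-neg : ∀ x → f (- x) ≈ - f x
  f-neg x = by-cases {x} {0#}
    (λ x≈0 → begin
      f (- x)  ≈⟨ f-cong (trans (-‿cong x≈0) -0#≈0#) ⟩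
      f 0#     ≈⟨ f0≈0 ⟩
      0#       ≈⟨ sym -0#≈0# ⟩
      - 0#     ≈⟨ -‿cong (sym (trans (f-cong x≈0) f0≈0)) ⟩
      - f x    ∎)
    λ x≉0 → lc₂ (- 1#) (f x - f (- x))
      (f-eqn {x} { - x} {0#}
        (λ x≈-x → x≉0 (*-cancelˡ 2≉0 (lc 1# x≈-x
          (solve 1 (λ x → :nat 2 :* x := :nat 2 :* :nat 0 :+ :nat 1 :* (x :- :- x)) refl x))))
        (solve 1 (λ x → :nat 0 :* (x :- :- x) := x :+ :- x) refl x))
      f0≈0
      (solve 3 (λ a b o → b := (:- a :+ (:- :nat 1) :* (o :* (a :- b) :- (a :+ b))) :+ (a :- b) :* (o :- :nat 0))
        refl (f x) (f (- x)) (f 0#))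

  f-eqn-1 : ∀ {x z} → ¬ x ≈ 1# → z * (x - 1#) ≈ x + 1# → f z * (f x - 1#) ≈ f x + 1#
  f-eqn-1 {x} {z} x≉1 z≈ = begin
    f z * (f x - 1#)    ≈⟨ *-congˡ (+-congˡ (-‿cong (sym f1≈1))) ⟩
    f z * (f x - f 1#)  ≈⟨ f-eqn x≉1 z≈ ⟩
    f x + f 1#          ≈⟨ +-congˡ f1≈1 ⟩
    f x + 1#            ∎

  -- For t ≠ 1 and y ≠ 0 the pairs (ty , y) and (t , 1) have the same quotient (t + 1) / (t - 1).
  f-* : ∀ t y → f (t * y) ≈ f t * f y
  f-* t y = by-cases {t} {1#}
    (λ t≈1 → begin
      f (t * y)    ≈⟨ f-cong (trans (*-congʳ t≈1) (*-identityˡ y)) ⟩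
      f y          ≈⟨ sym (*-identityˡ (f y)) ⟩
      1# * f y     ≈⟨ *-congʳ (sym (trans (f-cong t≈1) f1≈1)) ⟩
      f t * f y    ∎)
    λ t≉1 → by-cases {y} {0#}
    (λ y≈0 → begin
      f (t * y)    ≈⟨ f-cong (trans (*-congˡ y≈0) (zeroʳ t)) ⟩
      f 0#         ≈⟨ f0≈0 ⟩
      0#           ≈⟨ sym (zeroʳ (f t)) ⟩
      f t * 0#     ≈⟨ *-congˡ (sym (trans (f-cong y≈0) f0≈0)) ⟩
      f t * f y    ∎)
    λ y≉0 → stable λ ne → inverse (x-y≉0 t≉1) λ (i , ti≈1) → ne
      (*-cancelˡ 2≉0 (lc₂ (f t - 1#) (- (f (t * y) - f y))
        (f-eqn {z = (t + 1#) * i}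
          (λ ty≈y → t≉1 (*-cancelˡ y≉0 (trans (*-comm y t) (trans ty≈y (sym (*-identityʳ y))))))
          (lc (y * (t + 1#)) ti≈1
            (solve 3 (λ t y i → ((t :+ :nat 1) :* i) :* (t :* y :- y) :=
                (t :* y :+ y) :+ (y :* (t :+ :nat 1)) :* ((t :- :nat 1) :* i :- :nat 1)) refl t y i)))
        (f-eqn-1 {z = (t + 1#) * i} t≉1
          (lc (t + 1#) ti≈1
            (solve 2 (λ t i → ((t :+ :nat 1) :* i) :* (t :- :nat 1) :=
                (t :+ :nat 1) :+ (t :+ :nat 1) :* ((t :- :nat 1) :* i :- :nat 1)) refl t i)))
        (solve 4 (λ X Y T F → :nat 2 :* X := (:nat 2 :* (T :* Y) :+ (T :- :nat 1) :* (F :* (X :- Y) :- (X :+ Y)))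
            :+ (:- (X :- Y)) :* (F :* (T :- :nat 1) :- (T :+ :nat 1)))
          refl (f (t * y)) (f y) (f t) (f ((t + 1#) * i)))))

  f-^ : ∀ x n → f (x ^ n) ≈ f x ^ n
  f-^ x zero    = f1≈1
  f-^ x (suc n) = trans (f-* x (x ^ n)) (*-congˡ (f-^ x n))

  -- f 5 is computed from 5 = (3 + 2) / (3 - 2) and from 5 / 3 = (4 + 1) / (4 - 1).
  f2≈2 : f (nat 2) ≈ nat 2
  f2≈2 = stable λ ne → inverse (nat≉0 2) λ (i , 3i≈1) →
    let a = f (nat 2)
        b = f (nat 3)
        c = f (nat 5)
        z = nat 5 * i
        w = f z
        b≈ : b * (a - 1#) ≈ a + 1#
        b≈ = f-eqn-1 (λ e → 1≉2 (sym e)) (solve 0 (:nat 3 :* (:nat 2 :- :nat 1) := :nat 2 :+ :nat 1) refl)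
        c≈ : c * (b - a) ≈ b + a
        c≈ = f-eqn
          (λ e → 1≉0 (lc 1# e (solve 0 (:nat 1 := :nat 0 :+ :nat 1 :* (:nat 3 :- :nat 2)) refl)))
          (solve 0 (:nat 5 :* (:nat 3 :- :nat 2) := :nat 3 :+ :nat 2) refl)
        c≈wb : c ≈ w * b
        c≈wb = trans (f-cong (sym (lc (nat 5) 3i≈1
          (solve 1 (λ i → (:nat 5 :* i) :* :nat 3 := :nat 5 :+ :nat 5 :* (:nat 3 :* i :- :nat 1)) refl i)))) (f-* z (nat 3))
        w≈′ : w * (f (nat 2 * nat 2) - 1#) ≈ f (nat 2 * nat 2) + 1#
        w≈′ = f-eqn-1
          (λ e → nat≉0 2 (lc 1# e (solve 0 (:nat 3 := :nat 0 :+ :nat 1 :* (:nat 2 :* :nat 2 :- :nat 1)) refl)))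
          (lc (nat 5) 3i≈1
            (solve 1 (λ i → (:nat 5 :* i) :* (:nat 2 :* :nat 2 :- :nat 1) :=
                (:nat 2 :* :nat 2 :+ :nat 1) :+ :nat 5 :* (:nat 3 :* i :- :nat 1)) refl i))
        f4≈ = f-* (nat 2) (nat 2)
        w≈ : w * (a * a - 1#) ≈ a * a + 1#
        w≈ = trans (*-congˡ (+-congʳ (sym f4≈))) (trans w≈′ (+-congʳ f4≈))
        -- Eliminating `b` and `w` gives two expressions for `(a * a + 1) / c`: `1 + 2 a - a * a`
        -- here and `(a - 1) * (a - 1)` in `s₂`. As `c` and `a` are nonzero, equating them forces
        -- `a = 2`.
        s₁ : c * (1# + nat 2 * a - a * a) ≈ a * a + 1#
        s₁ = lc₂ (a - 1#) (- (c - 1#)) c≈ b≈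
          (solve 3 (λ a b c → c :* (:nat 1 :+ :nat 2 :* a :- a :* a) :=
              ((a :* a :+ :nat 1) :+ (a :- :nat 1) :* (c :* (b :- a) :- (b :+ a)))
                :+ (:- (c :- :nat 1)) :* (b :* (a :- :nat 1) :- (a :+ :nat 1))) refl a b c)
        a+1≉0 : ¬ a + 1# ≈ 0#
        a+1≉0 e = f-inj {nat 2} { - 1#}
          (λ e′ → nat≉0 2 (lc 1# e′ (solve 0 (:nat 3 := :nat 0 :+ :nat 1 :* (:nat 2 :- :- :nat 1)) refl)))
          (lc₂ 1# (- 1#) e (trans (f-neg 1#) (-‿cong f1≈1))
            (solve 2 (λ a m → a := (m :+ :nat 1 :* (a :+ :nat 1 :- :nat 0)) :+ (:- :nat 1) :* (m :- :- :nat 1)) refl a (f (- 1#))))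
        s₂ : c * ((a - 1#) * (a - 1#)) ≈ a * a + 1#
        s₂ = *-cancelˡ a+1≉0 (lc ((a - 1#) * (a * a - 1#)) c≈wb (lc₂ (b * (a - 1#)) (a * a + 1#) w≈ b≈
          (solve 4 (λ a b c w → (a :+ :nat 1) :* (c :* ((a :- :nat 1) :* (a :- :nat 1))) :=
              ((((a :+ :nat 1) :* (a :* a :+ :nat 1)) :+ ((a :- :nat 1) :* (a :* a :- :nat 1)) :* (c :- w :* b))
              :+ (b :* (a :- :nat 1)) :* (w :* (a :* a :- :nat 1) :- (a :* a :+ :nat 1)))
              :+ (a :* a :+ :nat 1) :* (b :* (a :- :nat 1) :- (a :+ :nat 1))) refl a b c w)))
    in ne (*-cancelˡ (*-≉0 2≉0 (*-≉0 (f≉0 (nat≉0 4)) (f≉0 2≉0))) (lc₂ 1# (- 1#) s₂ s₁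
      (solve 2 (λ a c → (:nat 2 :* (c :* a)) :* a :=
          ((:nat 2 :* (c :* a)) :* :nat 2 :+ :nat 1 :* (c :* ((a :- :nat 1) :* (a :- :nat 1)) :- (a :* a :+ :nat 1)))
          :+ (:- :nat 1) :* (c :* (:nat 1 :+ :nat 2 :* a :- a :* a) :- (a :* a :+ :nat 1))) refl a c)))

  private
    -- n + 2 = n · z with z = ((n + 1) + 1) / ((n + 1) - 1)
    f-nat-step : ∀ n → ¬ nat n ≈ 0# → f (nat n) ≈ nat n → f (nat (suc n)) ≈ nat (suc n) →
                 f (nat (2 ℕ.+ n)) ≈ nat (2 ℕ.+ n)
    f-nat-step n n≉0 fn≈n fn+1≈n+1 = stable λ ne → inverse n≉0 λ (i , ni≈1) →
      let N = nat n
          S = nat (suc n)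
          z = (S + 1#) * i
          S≈ : S ≈ 1# + N
          S≈ = nat-suc n
          T≈ : nat (2 ℕ.+ n) ≈ S + 1#
          T≈ = trans (nat-suc (suc n)) (+-comm _ _)
          z≈ : z * (S - 1#) ≈ S + 1#
          z≈ = lc₂ ((S + 1#) * i) (S + 1#) S≈ ni≈1
            (solve 3 (λ N S i → ((S :+ :nat 1) :* i) :* (S :- :nat 1) :=
                ((S :+ :nat 1) :+ ((S :+ :nat 1) :* i) :* (S :- (:nat 1 :+ N)))
                 :+ (S :+ :nat 1) :* (N :* i :- :nat 1)) refl N S i)
          S≉1 : ¬ S ≈ 1#
          S≉1 e = n≉0 (lc₂ 1# (- 1#) e S≈
            (solve 2 (λ N S → N := (:nat 0 :+ :nat 1 :* (S :- :nat 1)) :+ (:- :nat 1) :* (S :- (:nat 1 :+ N))) refl N S))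
          zN≈ : z * N ≈ S + 1#
          zN≈ = lc (S + 1#) ni≈1
            (solve 3 (λ N S i → ((S :+ :nat 1) :* i) :* N := (S :+ :nat 1) :+ (S :+ :nat 1) :* (N :* i :- :nat 1)) refl N S i)
          fz≈ : f z * (S - 1#) ≈ S + 1#
          fz≈ = trans (*-congˡ (+-congʳ (sym fn+1≈n+1))) (trans (f-eqn-1 S≉1 z≈) (+-congʳ fn+1≈n+1))
      in ne (begin
        f (nat (2 ℕ.+ n))  ≈⟨ f-cong (trans T≈ (sym zN≈)) ⟩
        f (z * N)          ≈⟨ f-* z N ⟩
        f z * f N          ≈⟨ *-congˡ fn≈n ⟩
        f z * N            ≈⟨ lc₂ 1# (- f z) fz≈ S≈
                                (solve 3 (λ N S w → w :* N := ((S :+ :nat 1) :+ :nat 1 :* (w :* (S :- :nat 1) :- (S :+ :nat 1)))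
                                  :+ (:- w) :* (S :- (:nat 1 :+ N))) refl N S (f z)) ⟩
        S + 1#             ≈⟨ sym T≈ ⟩
        nat (2 ℕ.+ n)      ∎)

  -- The inductive step divides by `n` and so cannot start from 0; this is why `f 2 = 2` needs a
  -- separate argument.
  f-nat : ∀ n → f (nat n) ≈ nat n
  f-nat 0                 = f0≈0
  f-nat 1                 = f1≈1
  f-nat 2                 = f2≈2
  f-nat (suc (suc (suc n))) = f-nat-step (suc n) (nat≉0 n) (f-nat (suc n)) (f-nat (suc (suc n)))

  f-π^ : ∀ k → f (π ^ k) ≈ π ^ k
  f-π^ k = trans (f-^ π k) (^-congˡ k (f-nat p))


-- Preservation of integrality, and rigidity

module Rigidity {p : ℕ} .{{_ : NonZero p}} {F : HenselianField p} (φ : QuotientMap F) where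
  open HenselianField F
  open QuotientMap φ
  open FieldProperties F
  open QuotientMapProperties φ
  open SetoidReasoning setoid

  -- f (1 + π x) is an N-th power for arbitrarily large N, and π^k f (1 + π x) is integral for one fixed k.
  f-principal-unit : ∀ {x} → Int x → Int (f (1# + π * x))
  f-principal-unit {x} int with bounded (f (1# + π * x))
  ... | k , intk with root int k
  ...   | y , y^N≈ with valuation (f y)
  ...     | inj₁ intfy = Int-resp (sym e≈) (Int-^ (suc (k ℕ.* p)) intfy)
    where
    e≈ : f (1# + π * x) ≈ f y ^ suc (k ℕ.* p)
    e≈ = trans (f-cong (sym y^N≈)) (f-^ y (suc (k ℕ.* p)))
  -- Here `f y` is the inverse of `π s`, so `e * π ^ N * s ^ N = 1`. Since `N = 1 + k + d` and
  -- `π ^ k * e` is integral, the left side is `π` times an integral element.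
  ...     | inj₂ (s , ints , eq) = ⊥-elim (π-nonunit
              (Int-* (Int-* intk (Int-^ d Int-π)) (Int-^ N ints))
              (begin
    π * (((π ^ k * e) * π ^ d) * s ^ N)      ≈⟨ solve 5 (λ p q e d s → p :* (((q :* e) :* d) :* s) :=
                                                (e :* (p :* (q :* d))) :* s) refl π (π ^ k) e (π ^ d) (s ^ N) ⟩
    e * (π * (π ^ k * π ^ d)) * s ^ N        ≈⟨ *-congʳ (*-congˡ (*-congˡ (sym (^-homo-* π k d)))) ⟩
    e * π ^ suc (k ℕ.+ d) * s ^ N            ≡⟨ ≡.cong (λ j → e * π ^ suc j * s ^ N) (ℕ.m+[n∸m]≡n (ℕ.m≤m*n k p)) ⟩
    e * π ^ N * s ^ N                        ≈⟨ *-congʳ (*-congʳ e≈) ⟩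
    f y ^ N * π ^ N * s ^ N                  ≈⟨ *-assoc _ _ _ ⟩
    f y ^ N * (π ^ N * s ^ N)                ≈⟨ *-congˡ (sym (^-distrib-* π s N)) ⟩
    f y ^ N * (π * s) ^ N                    ≈⟨ sym (^-distrib-* (f y) (π * s) N) ⟩
    (f y * (π * s)) ^ N                      ≈⟨ ^-congˡ N eq ⟩
    1# ^ N                                   ≈⟨ 1^ N ⟩
    1#                                       ∎))
    where
    N d : ℕ
    N = suc (k ℕ.* p)
    d = k ℕ.* p ℕ.∸ k
    e : Carrier
    e = f (1# + π * x)
    e≈ : e ≈ f y ^ N
    e≈ = trans (f-cong (sym y^N≈)) (f-^ y (suc (k ℕ.* p)))
    1^ : ∀ n → 1# ^ n ≈ 1#
    1^ zero    = refl
    1^ (suc n) = trans (*-identityˡ _) (1^ n)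

  -- If `v ≡ n` modulo `π`, then `u n` is a principal unit, so `f u * n = f (u n)` is integral. Were
  -- `f u` the inverse of `π t`, then `n = π t f (u n)` and with it the unit `v` would be divisible
  -- by `π`.
  f-unit : ∀ {u v} → Int u → Int v → u * v ≈ 1# → Int (f u)
  f-unit {u} {v} intu intv uv≈1 with residue intv
  ... | n , s , ints , v≈ with valuation (f u)
  ...   | inj₁ int = int
  ...   | inj₂ (t , intt , eq) = ⊥-elim (π-nonunit
            (Int-+ (Int-* intu (Int-* intw intt)) (Int-* ints intu))
            (lc (π * t * u) fw≈ (lc (nat n * u) eq (lc₂ (- u) 1# v≈ uv≈1
              (solve 8 (λ p n u v s t a b → p :* (u :* (b :* t) :+ s :* u) :=
                  (((:nat 1 :+ (p :* t :* u) :* (b :- a :* n))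
                  :+ (n :* u) :* (a :* (p :* t) :- :nat 1)) :+ (:- u) :* (v :- (n :+ p :* s)))
                  :+ :nat 1 :* (u :* v :- :nat 1)) refl π (nat n) u v s t (f u) (f (u * nat n)))))))
    where
    intw : Int (f (u * nat n))
    intw = Int-resp (f-cong (lc₂ (- 1#) u uv≈1 v≈
      (solve 5 (λ p n u v s → :nat 1 :+ p :* (:- (s :* u)) := (u :* n :+ (:- :nat 1) :* (u :* v :- :nat 1))
         :+ u :* (v :- (n :+ p :* s))) refl π (nat n) u v s)))
      (f-principal-unit (Int-neg (Int-* ints intu)))
    fw≈ : f (u * nat n) ≈ f u * nat n
    fw≈ = trans (f-* u (nat n)) (*-congˡ (f-nat n))

  -- Suppose `f x` is not integral. Whenever `x = π ^ k * t`, `t` cannot be a unit, as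
  -- `f x = π ^ k * f t` would be integral by `f-unit`; so another `π` can be split off. Hence
  -- `x = 0`, contradicting that `f x` is invertible.
  f-Int : ∀ {x} → Int x → Int (f x)
  f-Int {x} int with valuation (f x)
  ... | inj₁ intfx = intfx
  ... | inj₂ (s , ints , eq) =
    ⊥-elim (unit≉0 eq (trans (f-cong (separated x divisible)) f0≈0))
    where
    divisible : ∀ k → ∃ λ t → Int t × x ≈ π ^ k * t
    divisible zero = x , int , sym (*-identityˡ x)
    divisible (suc k) with divisible k
    ... | t , intt , x≈ with valuation (π⁻¹ * t)
    ...   | inj₁ int′ = π⁻¹ * t , int′ , lc₂ 1# (- (π ^ k * t)) x≈ π*π⁻¹≈1
            (solve 5 (λ x p q k t → x := (((p :* k) :* (q :* t)) :+ :nat 1 :* (x :- k :* t))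
              :+ (:- (k :* t)) :* (p :* q :- :nat 1)) refl x π π⁻¹ (π ^ k) t)
    ...   | inj₂ (v , intv , eq′) = ⊥-elim (π-nonunit
              (Int-* (Int-* (Int-^ k Int-π) (f-unit intt intv tv≈1)) ints)
              (trans (lc (- (π * s)) fx≈
                (solve 5 (λ x p k t s → p :* ((k :* t) :* s) := x :* (p :* s) :+ (:- (p :* s)) :* (x :- k :* t))
                  refl (f x) π (π ^ k) (f t) s)) eq))
      where
      tv≈1 : t * v ≈ 1#
      tv≈1 = lc₂ (- (t * v)) 1# π*π⁻¹≈1 eq′
        (solve 4 (λ p q t v → t :* v := (:nat 1 :+ (:- (t :* v)) :* (p :* q :- :nat 1))
          :+ :nat 1 :* ((q :* t) :* (p :* v) :- :nat 1)) refl π π⁻¹ t v)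
      fx≈ : f x ≈ π ^ k * f t
      fx≈ = trans (f-cong x≈) (trans (f-* (π ^ k) t) (*-congʳ (f-π^ k)))

  f-fixes-Int : ∀ {x} → Int x → f x ≈ x
  f-fixes-Int {x} int = stable λ fx≉x →
    let x≉0 : ¬ x ≈ 0#
        x≉0 x≈0 = fx≉x (trans (f-cong x≈0) (trans f0≈0 (sym x≈0)))
    in inverse (*-≉0 (nat≉0 1) x≉0) λ (h , 2xh≈1) →
       fx≉x (x-y≈0⇒x≈y _ _ (separated _ (close h 2xh≈1 (bounded h))))
    where
    close : ∀ h → (nat 2 * x) * h ≈ 1# → (∃ λ c → Int (π ^ c * h)) →
            ∀ m → ∃ λ g → Int g × f x - x ≈ π ^ m * g
    -- `x + n` is close to `2 x`, whose inverse is `h`. Of the extra precision `suc c`, the part `c`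
    -- absorbs the denominator of `h` and the remaining 1 makes `(x + n) * h` a principal unit, with
    -- inverse `e`.
    close h 2xh≈1 (c , inti) m with approximate int (m ℕ.+ suc c)
    ... | n , s , ints , x≈ with principal-unit (Int-neg (Int-* (Int-^ m Int-π) (Int-* inti ints)))
    ...   | e , inte , eq =
      -- From `f x - x = (f x - N) - (x - N)`: the first term is `f t * (f x + N)` with
      -- `f t = M * f r`, the second is `M * (π * C) * s`.
      f r * (f x + N) - π * C * s ,
      Int-+ (Int-* (f-Int intr) (Int-+ (f-Int int) (Int-nat n)))
            (Int-neg (Int-* (Int-* Int-π (Int-^ c Int-π)) ints)) ,
      lc (f x + N) ft≈ (lc₂ (- 1#) (- 1#) x≈N fx≈
        (solve 9 (λ x y N M p C s w u → y :- x :=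
            ((M :* (w :* (y :+ N) :- p :* C :* s) :+ (y :+ N) :* (u :- M :* w))
            :+ (:- :nat 1) :* (x :- (N :+ M :* (p :* C) :* s)))
            :+ (:- :nat 1) :* (u :* (y :+ N) :- (y :- N))) refl x (f x) N M π C s (f r) (f t)))
      where
      N M C r t : Carrier
      N = nat n
      M = π ^ m
      C = π ^ c
      r = π * s * (C * h) * e
      t = M * r
      intr : Int r
      intr = Int-* (Int-* (Int-* Int-π ints) inti) inte
      x≈N : x ≈ N + M * (π * C) * s
      x≈N = trans x≈ (+-congˡ (*-congʳ (^-homo-* π m (suc c))))
      ft≈ : f t ≈ M * f r
      ft≈ = trans (f-* M r) (*-congʳ (f-π^ m))
      x+N≈ : (x + N) * (h * e) ≈ 1#
      x+N≈ = lc e 2xh≈1 (lc₂ 1# (- (h * e)) eq x≈N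
        (solve 8 (λ x N M p C s h e → (x :+ N) :* (h :* e) :=
            ((:nat 1 :+ e :* ((:nat 2 :* x) :* h :- :nat 1))
            :+ :nat 1 :* ((:nat 1 :+ p :* (:- (M :* ((C :* h) :* s)))) :* e :- :nat 1))
            :+ (:- (h :* e)) :* (x :- (N :+ M :* (p :* C) :* s))) refl x N M π C s h e))
      -- The functional equation for the pair (x , - N), whose quotient is `t`.
      fx≈ : f t * (f x + N) ≈ f x - N
      fx≈ = begin
        f t * (f x + N)        ≈⟨ *-congˡ (+-congˡ (trans (sym (-‿involutive N)) (-‿cong (sym f-N)))) ⟩
        f t * (f x - f (- N))  ≈⟨ f-eqn x≉-N (lc₂ (M * (π * C) * s) (- 1#) x+N≈ x≈N
          (solve 8 (λ x N M p C s h e → (M :* (p :* s :* (C :* h) :* e)) :* (x :- :- N) :=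
              ((x :+ :- N) :+ (M :* (p :* C) :* s) :* ((x :+ N) :* (h :* e) :- :nat 1))
              :+ (:- :nat 1) :* (x :- (N :+ M :* (p :* C) :* s))) refl x N M π C s h e)) ⟩
        f x + f (- N)          ≈⟨ +-congˡ f-N ⟩
        f x - N                ∎
        where
        f-N : f (- N) ≈ - N
        f-N = trans (f-neg N) (-‿cong (f-nat n))
        x≉-N : ¬ x ≈ - N
        x≉-N x≈-N = unit≉0 x+N≈ (trans (+-congʳ x≈-N) (-‿inverseˡ N))

  f-fixes : ∀ x → f x ≈ x
  f-fixes x with bounded x
  ... | k , int = *-cancelˡ (unit≉0 (^-inverse k)) (begin
    π ^ k * f x      ≈⟨ *-congʳ (sym (f-π^ k)) ⟩
    f (π ^ k) * f x  ≈⟨ sym (f-* (π ^ k) x) ⟩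
    f (π ^ k * x)    ≈⟨ f-fixes-Int int ⟩
    π ^ k * x        ∎)

-- The fraction field of a complete ring

record CompleteRing (p : ℕ) : Set₁ where
  field
    commutativeRing : CommutativeRing 0ℓ 0ℓ
  open CommutativeRing commutativeRing public hiding (zero)
  open RingTools commutativeRing public
  open Evaluation commutativeRing public
  π : Carrier
  π = nat p
  field
    stable    : ∀ {a b} → ¬ ¬ a ≈ b → a ≈ b
    nat≉0     : ∀ n → ¬ nat (suc n) ≈ 0#
    π-nonunit : ∀ s → ¬ π * s ≈ 1#
    π-cancel  : ∀ {a b} → π * a ≈ π * b → a ≈ b
    separated : ∀ a → (∀ k → ∃ λ b → a ≈ π ^ k * b) → a ≈ 0#
    residue   : ∀ a → ∃ λ n → n ℕ.< p × ∃ λ b → a ≈ nat n + π * b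
    fixpoint  : ∀ P b → ∃ λ z → z ≈ b + π * eval P z
    -- Kept abstract so that it can be the digit shift: the operations and equality of fractions
    -- then unfold to those of `Qp`.
    scale     : ℕ → Carrier → Carrier
    scale-π^  : ∀ l a → scale l a ≈ π ^ l * a

-- Units and roots in a complete ring

module CompleteRingProperties {p : ℕ} (O : CompleteRing p) where
  open CompleteRing O
  open SetoidReasoning setoid

  -- The inverse solves `c = 1 - π b c`, a fixed-point equation.
  principal-unit : ∀ b → ∃ λ c → (1# + π * b) * c ≈ 1#
  principal-unit b = let (c , c≈) = fixpoint (const (- b) ⊗ var) 1# in c , lc 1# c≈
    (solve 3 (λ p b c → (:nat 1 :+ p :* b) :* c :=
        :nat 1 :+ :nat 1 :* (c :- (:nat 1 :+ p :* (:- b :* c)))) refl π b c)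

  nat-1+* : ∀ m n → nat (suc (m ℕ.* n)) ≈ 1# + nat m * nat n
  nat-1+* m n = trans (nat-suc (m ℕ.* n)) (+-congˡ (nat-* m n))

  principal-multiple-unit : ∀ {a y w} → a * y ≈ 1# + π * w → ∃ λ c → a * c ≈ 1#
  principal-multiple-unit {a} {y} {w} e = let (c , c≈) = principal-unit w in
    y * c , trans (sym (*-assoc a y c)) (trans (*-congʳ e) c≈)

  -- A Bézout coefficient of `n`, with the right sign, inverts `a` modulo `π`; the product is a
  -- principal unit.
  bézout-unit : ∀ {n a b} → a ≈ nat n + π * b → Bézout.Identity 1 p n → ∃ λ c → a * c ≈ 1#
  bézout-unit {n} {a} {b} a≈ (Bézout.-+ x y eq) = principal-multiple-unit {y = nat y} {nat x + nat y * b}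
    (lc₂ (nat y) (- 1#) a≈ combination
      (solve 6 (λ p a n b x y → a :* y :=
          ((:nat 1 :+ p :* (x :+ y :* b)) :+ y :* (a :- (n :+ p :* b)))
          :+ (:- :nat 1) :* (:nat 1 :+ x :* p :- y :* n)) refl π a (nat n) b (nat x) (nat y)))
    where
    combination : 1# + nat x * π ≈ nat y * nat n
    combination = trans (sym (nat-1+* x p)) (trans (reflexive (≡.cong nat eq)) (nat-* y n))
  bézout-unit {n} {a} {b} a≈ (Bézout.+- x y eq) = principal-multiple-unit {y = - nat y} { - (nat x + nat y * b)}
    (lc₂ (- nat y) (- 1#) a≈ combination
      (solve 6 (λ p a n b x y → a :* (:- y) :=
          ((:nat 1 :+ p :* (:- (x :+ y :* b))) :+ (:- y) :* (a :- (n :+ p :* b)))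
          :+ (:- :nat 1) :* (:nat 1 :+ y :* n :- x :* p)) refl π a (nat n) b (nat x) (nat y)))
    where
    combination : 1# + nat y * nat n ≈ nat x * π
    combination = trans (sym (nat-1+* y n)) (trans (reflexive (≡.cong nat eq)) (nat-* x p))

  -- Decided by the lowest digit: a nonzero one is coprime to the prime `p`.
  unit-or-multiple : Prime p → ∀ a → (∃ λ b → a ≈ π * b) ⊎ (∃ λ b → a * b ≈ 1#)
  unit-or-multiple pr a = let (n , n<p , b , a≈) = residue a in cases n b n<p a≈
    where
    cases : ∀ n b → n ℕ.< p → a ≈ nat n + π * b → (∃ λ b → a ≈ π * b) ⊎ (∃ λ b → a * b ≈ 1#)
    cases zero    b n<p a≈ = inj₁ (b , trans a≈ (+-identityˡ _))
    cases (suc n) b n<p a≈ = inj₂ (bézout-unit {suc n} a≈ (coprime-Bézout (prime⇒coprime pr n<p)))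

  -- The terms of degree at least 2 in the binomial expansion of `(1 + π z) ^ m`, divided by
  -- `π * π`; the recursion multiplies the expansion by `1 + π z`.
  tail : ℕ → Poly Carrier
  tail zero    = const 0#
  tail (suc m) = (const (nat m) ⊗ (var ⊗ var)) ⊕ (tail m ⊗ (const 1# ⊕ (const π ⊗ var)))

  expand : ∀ z m → (1# + π * z) ^ m ≈ 1# + nat m * (π * z) + π * π * eval (tail m) z
  expand z zero = solve 2 (λ p z → :nat 1 := :nat 1 :+ :nat 0 :* (p :* z) :+ p :* p :* :nat 0) refl π z
  expand z (suc m) = lc (1# + π * z) (expand z m) (lc (- (π * z)) (nat-suc m)
    (solve 6 (λ p z m S t u → (:nat 1 :+ p :* z) :* u :=
        ((:nat 1 :+ S :* (p :* z) :+ p :* p :* (m :* (z :* z) :+ t :* (:nat 1 :+ p :* z)))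
        :+ (:nat 1 :+ p :* z) :* (u :- (:nat 1 :+ m :* (p :* z) :+ p :* p :* t)))
        :+ (:- (p :* z)) :* (S :- (:nat 1 :+ m)))
      refl π z (nat m) (nat (suc m)) (eval (tail m) z) ((1# + π * z) ^ m)))

  -- For y = 1 + π z and N = 1 + k p, y ^ N = 1 + π b is the fixed-point equation z = b - π (k z + tail N (z)).
  root : ∀ b k → ∃ λ y → y ^ suc (k ℕ.* p) ≈ 1# + π * b
  root b k = let (z , z≈) = fixpoint (const (- 1#) ⊗ ((const (nat k) ⊗ var) ⊕ tail (suc (k ℕ.* p)))) b in
    1# + π * z , lc 1# (expand z (suc (k ℕ.* p))) (lc₂ (π * z) π N≈ z≈
    (solve 7 (λ p z b k N t u → u :=
        (((:nat 1 :+ p :* b) :+ :nat 1 :* (u :- (:nat 1 :+ N :* (p :* z) :+ p :* p :* t)))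
        :+ (p :* z) :* (N :- (:nat 1 :+ k :* p)))
        :+ p :* (z :- (b :+ p :* (:- :nat 1 :* (k :* z :+ t)))))
      refl π z b (nat k) (nat (suc (k ℕ.* p))) (eval (tail (suc (k ℕ.* p))) z) ((1# + π * z) ^ suc (k ℕ.* p))))
    where
    N≈ : nat (suc (k ℕ.* p)) ≈ 1# + nat k * π
    N≈ = nat-1+* k p

-- (k , a) stands for a / π^k.
module FractionField {p : ℕ} (O : CompleteRing p) where
  open CompleteRing O
  open CompleteRingProperties O

  Q : Set
  Q = ℕ × Carrier

  infix 4 _≈ᵠ_
  -- A record, so that x and y can be inferred from a proof of x ≈ᵠ y.
  record _≈ᵠ_ (x y : Q) : Set where
    constructor scaled
    field
      unscaled : scale (proj₁ y) (proj₂ x) ≈ scale (proj₁ x) (proj₂ y)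
  open _≈ᵠ_ public

  infixl 6 _+ᵠ_
  infixl 7 _*ᵠ_
  _+ᵠ_ _*ᵠ_ : Q → Q → Q
  (k , a) +ᵠ (l , b) = k ℕ.+ l , scale l a + scale k b
  (k , a) *ᵠ (l , b) = k ℕ.+ l , a * b

  -ᵠ_ : Q → Q
  -ᵠ (k , a) = k , - a

  π^-cancel : ∀ k {a b} → π ^ k * a ≈ π ^ k * b → a ≈ b
  π^-cancel zero    e = trans (sym (*-identityˡ _)) (trans e (*-identityˡ _))
  π^-cancel (suc k) e = π^-cancel k (π-cancel (trans (sym (*-assoc _ _ _)) (trans e (*-assoc _ _ _))))

  -- Fractions with numerator and denominator known up to ≈: cross-multiplication then turns
  -- each ring axiom into a polynomial identity.
  record IsFraction (x : Q) (K A : Carrier) : Set where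
    constructor _over_
    field
      numerator   : proj₂ x ≈ A
      denominator : π ^ proj₁ x ≈ K

  isFraction : ∀ x → IsFraction x (π ^ proj₁ x) (proj₂ x)
  isFraction x = refl over refl

  fraction-≈ : ∀ {x y K A L B} → IsFraction x K A → IsFraction y L B → L * A ≈ K * B → x ≈ᵠ y
  fraction-≈ (a≈ over k≈) (b≈ over l≈) e =
    scaled (trans (scale-π^ _ _) (trans (*-cong l≈ a≈) (trans e (trans (sym (*-cong k≈ b≈)) (sym (scale-π^ _ _))))))

  cross : ∀ {x y} → x ≈ᵠ y → π ^ proj₁ y * proj₂ x ≈ π ^ proj₁ x * proj₂ y
  cross (scaled e) = trans (sym (scale-π^ _ _)) (trans e (scale-π^ _ _))

  fraction-+ : ∀ {x y K A L B} → IsFraction x K A → IsFraction y L B →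
               IsFraction (x +ᵠ y) (K * L) (L * A + K * B)
  fraction-+ {k , _} {l , _} (a≈ over k≈) (b≈ over l≈) =
    +-cong (trans (scale-π^ _ _) (*-cong l≈ a≈)) (trans (scale-π^ _ _) (*-cong k≈ b≈))
      over trans (^-homo-* π k l) (*-cong k≈ l≈)

  fraction-* : ∀ {x y K A L B} → IsFraction x K A → IsFraction y L B → IsFraction (x *ᵠ y) (K * L) (A * B)
  fraction-* {k , _} {l , _} (a≈ over k≈) (b≈ over l≈) = *-cong a≈ b≈ over trans (^-homo-* π k l) (*-cong k≈ l≈)

  fraction-neg : ∀ {x K A} → IsFraction x K A → IsFraction (-ᵠ x) K (- A)
  fraction-neg (a≈ over k≈) = -‿cong a≈ over k≈

  embed : Carrier → Q
  embed a = 0 , a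

  fraction-embed : ∀ a → IsFraction (embed a) 1# a
  fraction-embed a = refl over refl

  private
    F = isFraction

    -- Combining the two cross-multiplied equations leaves a common factor `π ^ l`, which can be
    -- cancelled.
    ≈ᵠ-trans : ∀ {x y z} → x ≈ᵠ y → y ≈ᵠ z → x ≈ᵠ z
    ≈ᵠ-trans {k , a} {l , b} {m , c} e e′ = fraction-≈ (F (k , a)) (F (m , c))
      (π^-cancel l (lc₂ (π ^ m) (π ^ k) (cross e) (cross e′)
        (solve 6 (λ K L M a b c → L :* (M :* a) :=
            (L :* (K :* c) :+ M :* (L :* a :- K :* b)) :+ K :* (M :* b :- L :* c))
          refl (π ^ k) (π ^ l) (π ^ m) a b c)))

    +-congᵠ : ∀ {x x′ y y′} → x ≈ᵠ x′ → y ≈ᵠ y′ → x +ᵠ y ≈ᵠ x′ +ᵠ y′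
    +-congᵠ {x} {x′} {y} {y′} e e′ = fraction-≈ (fraction-+ (F x) (F y)) (fraction-+ (F x′) (F y′))
      (lc₂ (π ^ proj₁ y * π ^ proj₁ y′) (π ^ proj₁ x * π ^ proj₁ x′) (cross e) (cross e′)
        (solve 8 (λ K K′ L L′ a a′ b b′ → (K′ :* L′) :* (L :* a :+ K :* b) :=
            ((K :* L) :* (L′ :* a′ :+ K′ :* b′) :+ (L :* L′) :* (K′ :* a :- K :* a′))
              :+ (K :* K′) :* (L′ :* b :- L :* b′))
          refl (π ^ proj₁ x) (π ^ proj₁ x′) (π ^ proj₁ y) (π ^ proj₁ y′) (proj₂ x) (proj₂ x′) (proj₂ y) (proj₂ y′)))

    *-congᵠ : ∀ {x x′ y y′} → x ≈ᵠ x′ → y ≈ᵠ y′ → x *ᵠ y ≈ᵠ x′ *ᵠ y′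
    *-congᵠ {x} {x′} {y} {y′} e e′ = fraction-≈ (fraction-* (F x) (F y)) (fraction-* (F x′) (F y′))
      (lc₂ (π ^ proj₁ y′ * proj₂ y) (π ^ proj₁ x * proj₂ x′) (cross e) (cross e′)
        (solve 8 (λ K K′ L L′ a a′ b b′ → (K′ :* L′) :* (a :* b) :=
            ((K :* L) :* (a′ :* b′) :+ (L′ :* b) :* (K′ :* a :- K :* a′)) :+ (K :* a′) :* (L′ :* b :- L :* b′))
          refl (π ^ proj₁ x) (π ^ proj₁ x′) (π ^ proj₁ y) (π ^ proj₁ y′) (proj₂ x) (proj₂ x′) (proj₂ y) (proj₂ y′)))

    -‿congᵠ : ∀ {x y} → x ≈ᵠ y → -ᵠ x ≈ᵠ -ᵠ y
    -‿congᵠ {x} {y} e = fraction-≈ (fraction-neg (F x)) (fraction-neg (F y))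
      (lc (- 1#) (cross e)
        (solve 4 (λ K L a b → L :* (:- a) := K :* (:- b) :+ (:- :nat 1) :* (L :* a :- K :* b))
          refl (π ^ proj₁ x) (π ^ proj₁ y) (proj₂ x) (proj₂ y)))

    +-assocᵠ : ∀ x y z → (x +ᵠ y) +ᵠ z ≈ᵠ x +ᵠ (y +ᵠ z)
    +-assocᵠ x y z = fraction-≈ (fraction-+ (fraction-+ (F x) (F y)) (F z)) (fraction-+ (F x) (fraction-+ (F y) (F z)))
      (solve 6 (λ K L M a b c →
          (K :* (L :* M)) :* (M :* (L :* a :+ K :* b) :+ (K :* L) :* c) :=
          ((K :* L) :* M) :* ((L :* M) :* a :+ K :* (M :* b :+ L :* c)))
        refl (π ^ proj₁ x) (π ^ proj₁ y) (π ^ proj₁ z) (proj₂ x) (proj₂ y) (proj₂ z))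

    +-commᵠ : ∀ x y → x +ᵠ y ≈ᵠ y +ᵠ x
    +-commᵠ x y = fraction-≈ (fraction-+ (F x) (F y)) (fraction-+ (F y) (F x))
      (solve 4 (λ K L a b → (L :* K) :* (L :* a :+ K :* b) := (K :* L) :* (K :* b :+ L :* a))
        refl (π ^ proj₁ x) (π ^ proj₁ y) (proj₂ x) (proj₂ y))

    +-identityˡᵠ : ∀ x → embed 0# +ᵠ x ≈ᵠ x
    +-identityˡᵠ x = fraction-≈ (fraction-+ (fraction-embed 0#) (F x)) (F x)
      (solve 2 (λ K a → K :* (K :* :nat 0 :+ :nat 1 :* a) := (:nat 1 :* K) :* a) refl (π ^ proj₁ x) (proj₂ x))

    -‿inverseˡᵠ : ∀ x → -ᵠ x +ᵠ x ≈ᵠ embed 0#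
    -‿inverseˡᵠ x = fraction-≈ (fraction-+ (fraction-neg (F x)) (F x)) (fraction-embed 0#)
      (solve 2 (λ K a → :nat 1 :* (K :* (:- a) :+ K :* a) := (K :* K) :* :nat 0) refl (π ^ proj₁ x) (proj₂ x))

    *-assocᵠ : ∀ x y z → (x *ᵠ y) *ᵠ z ≈ᵠ x *ᵠ (y *ᵠ z)
    *-assocᵠ x y z = fraction-≈ (fraction-* (fraction-* (F x) (F y)) (F z)) (fraction-* (F x) (fraction-* (F y) (F z)))
      (solve 6 (λ K L M a b c → (K :* (L :* M)) :* ((a :* b) :* c) := ((K :* L) :* M) :* (a :* (b :* c)))
        refl (π ^ proj₁ x) (π ^ proj₁ y) (π ^ proj₁ z) (proj₂ x) (proj₂ y) (proj₂ z))

    *-commᵠ : ∀ x y → x *ᵠ y ≈ᵠ y *ᵠ x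
    *-commᵠ x y = fraction-≈ (fraction-* (F x) (F y)) (fraction-* (F y) (F x))
      (solve 4 (λ K L a b → (L :* K) :* (a :* b) := (K :* L) :* (b :* a))
        refl (π ^ proj₁ x) (π ^ proj₁ y) (proj₂ x) (proj₂ y))

    *-identityˡᵠ : ∀ x → embed 1# *ᵠ x ≈ᵠ x
    *-identityˡᵠ x = fraction-≈ (fraction-* (fraction-embed 1#) (F x)) (F x)
      (solve 2 (λ K a → K :* (:nat 1 :* a) := (:nat 1 :* K) :* a) refl (π ^ proj₁ x) (proj₂ x))

    distribʳᵠ : ∀ x y z → (y +ᵠ z) *ᵠ x ≈ᵠ y *ᵠ x +ᵠ z *ᵠ x
    distribʳᵠ x y z = fraction-≈ (fraction-* (fraction-+ (F y) (F z)) (F x))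
        (fraction-+ (fraction-* (F y) (F x)) (fraction-* (F z) (F x)))
      (solve 6 (λ K L M a b c →
          ((L :* K) :* (M :* K)) :* ((M :* b :+ L :* c) :* a) :=
          ((L :* M) :* K) :* ((M :* K) :* (b :* a) :+ (L :* K) :* (c :* a)))
        refl (π ^ proj₁ x) (π ^ proj₁ y) (π ^ proj₁ z) (proj₂ x) (proj₂ y) (proj₂ z))

  commutativeRingᵠ : CommutativeRing 0ℓ 0ℓ
  commutativeRingᵠ = record
    { Carrier = Q ; _≈_ = _≈ᵠ_ ; _+_ = _+ᵠ_ ; _*_ = _*ᵠ_ ; -_ = -ᵠ_ ; 0# = embed 0# ; 1# = embed 1#
    ; isCommutativeRing = record
      { isRing = record
        { +-isAbelianGroup = record
          { isGroup = record
            { isMonoid = record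
              { isSemigroup = record
                { isMagma = record
                  { isEquivalence = record
                    { refl = scaled refl ; sym = λ e → scaled (sym (unscaled e)) ; trans = ≈ᵠ-trans }
                  ; ∙-cong = +-congᵠ }
                ; assoc = +-assocᵠ }
              ; identity = +-identityˡᵠ , λ x →
                  ≈ᵠ-trans (+-commᵠ x (embed 0#)) (+-identityˡᵠ x) }
            ; inverse = -‿inverseˡᵠ , λ x →
                ≈ᵠ-trans (+-commᵠ x (-ᵠ x)) (-‿inverseˡᵠ x)
            ; ⁻¹-cong = -‿congᵠ }
          ; comm = +-commᵠ }
        ; *-cong = *-congᵠ
        ; *-assoc = *-assocᵠ
        ; *-identity = *-identityˡᵠ , λ x →
            ≈ᵠ-trans (*-commᵠ x (embed 1#)) (*-identityˡᵠ x)
        ; distrib = (λ x y z →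
            ≈ᵠ-trans (*-commᵠ x (y +ᵠ z))
              (≈ᵠ-trans (distribʳᵠ x y z)
                (+-congᵠ (*-commᵠ y x) (*-commᵠ z x))))
          , distribʳᵠ }
      ; *-comm = *-commᵠ } }

  private
    module K = CommutativeRing commutativeRingᵠ
    module KT = RingTools commutativeRingᵠ
    open SetoidReasoning K.setoid

  embed-cong : ∀ {a b} → a ≈ b → embed a ≈ᵠ embed b
  embed-cong {a} {b} e = fraction-≈ (fraction-embed a) (fraction-embed b) (*-congˡ e)

  embed-injective : ∀ {a b} → embed a ≈ᵠ embed b → a ≈ b
  embed-injective {a} {b} e = trans (sym (*-identityˡ a)) (trans (cross e) (*-identityˡ b))

  embed-+ : ∀ a b → embed (a + b) ≈ᵠ embed a +ᵠ embed b
  embed-+ a b = fraction-≈ (fraction-embed (a + b)) (fraction-+ (fraction-embed a) (fraction-embed b))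
    (solve 2 (λ a b → (:nat 1 :* :nat 1) :* (a :+ b) := :nat 1 :* (:nat 1 :* a :+ :nat 1 :* b)) refl a b)

  embed-^ : ∀ a n → embed (a ^ n) ≈ᵠ embed a KT.^ n
  embed-^ a zero    = K.refl
  embed-^ a (suc n) = K.*-congˡ (embed-^ a n)

  embed-nat : ∀ n → embed (nat n) ≈ᵠ KT.nat n
  embed-nat zero    = K.refl
  embed-nat (suc n) = begin
    embed (nat (suc n))           ≈⟨ embed-cong (nat-suc n) ⟩
    embed (1# + nat n)            ≈⟨ embed-+ 1# (nat n) ⟩
    embed 1# +ᵠ embed (nat n)     ≈⟨ K.+-congˡ (embed-nat n) ⟩
    embed 1# +ᵠ KT.nat n          ≈⟨ KT.nat-suc n ⟨
    KT.nat (suc n)                ∎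

  embed-π^-* : ∀ k x → embed (π ^ k) *ᵠ x ≈ᵠ KT.nat p KT.^ k *ᵠ x
  embed-π^-* k x = K.*-congʳ (begin
    embed (π ^ k)         ≈⟨ embed-^ π k ⟩
    embed π KT.^ k        ≈⟨ KT.^-congˡ k (embed-nat p) ⟩
    KT.nat p KT.^ k       ∎)

  embed-π-* : ∀ x → embed π *ᵠ x ≈ᵠ KT.nat p *ᵠ x
  embed-π-* x = K.*-congʳ (embed-nat p)

  -- Integrality in the fraction field

  Integral : Q → Set
  Integral x = ∃ λ a → x ≈ᵠ embed a

  IntegralOrInverse : Q → Set
  IntegralOrInverse x = Integral x ⊎ ∃ λ s → Integral s × x *ᵠ (KT.nat p *ᵠ s) ≈ᵠ embed 1#

  integral-or-inverse-resp : ∀ {x y} → x ≈ᵠ y → IntegralOrInverse y → IntegralOrInverse x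
  integral-or-inverse-resp x≈y (inj₁ (c , e))       = inj₁ (c , K.trans x≈y e)
  integral-or-inverse-resp x≈y (inj₂ (s , int , e)) = inj₂ (s , int , K.trans (K.*-congʳ x≈y) e)

  -- Cancel `π` from numerator and denominator until the denominator is gone, or the numerator is a
  -- unit and the fraction can be inverted.
  integral-or-inverse : Prime p → ∀ k a → IntegralOrInverse (k , a)
  integral-or-inverse pr zero    a = inj₁ (a , K.refl)
  integral-or-inverse pr (suc k) a = cases (unit-or-multiple pr a)
    where
    cases : (∃ λ b → a ≈ π * b) ⊎ (∃ λ b → a * b ≈ 1#) → IntegralOrInverse (suc k , a)
    cases (inj₁ (b , a≈πb)) = integral-or-inverse-resp
      (fraction-≈ (isFraction (suc k , a)) (isFraction (k , b))
        (lc (π ^ k) a≈πb (solve 4 (λ p P a b → P :* a := (p :* P) :* b :+ P :* (a :- p :* b)) refl π (π ^ k) a b)))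
      (integral-or-inverse pr k b)
    cases (inj₂ (b , ab≈1)) = inj₂ (embed (π ^ k * b) , (π ^ k * b , K.refl) , (begin
      (suc k , a) *ᵠ (KT.nat p *ᵠ embed (π ^ k * b))   ≈⟨ K.*-congˡ (embed-π-* (embed (π ^ k * b))) ⟨
      (suc k , a) *ᵠ (embed π *ᵠ embed (π ^ k * b))    ≈⟨ fraction-≈
        (fraction-* (isFraction (suc k , a)) (fraction-* (fraction-embed π) (fraction-embed (π ^ k * b))))
        (fraction-embed 1#)
        (lc (π * π ^ k) ab≈1 (solve 4 (λ p P a b → :nat 1 :* (a :* (p :* (P :* b))) :=
            ((p :* P) :* (:nat 1 :* :nat 1)) :* :nat 1 :+ (p :* P) :* (a :* b :- :nat 1))
          refl π (π ^ k) a b)) ⟩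
      embed 1#                                         ∎))

  bounded-denominator : ∀ x → Integral (KT.nat p KT.^ proj₁ x *ᵠ x)
  bounded-denominator x@(k , a) = a , (begin
    KT.nat p KT.^ k *ᵠ x    ≈⟨ embed-π^-* k x ⟨
    embed (π ^ k) *ᵠ x      ≈⟨ fraction-≈ (fraction-* (fraction-embed (π ^ k)) (isFraction x)) (fraction-embed a)
                                 (solve 2 (λ P a → :nat 1 :* (P :* a) := (:nat 1 :* P) :* a) refl (π ^ k) a) ⟩
    embed a                 ∎)

  separatedᵠ : ∀ x → (∀ k → ∃ λ s → Integral s × x ≈ᵠ KT.nat p KT.^ k *ᵠ s) → x ≈ᵠ embed 0#
  separatedᵠ x@(l , a) h = fraction-≈ (isFraction x) (fraction-embed 0#)
    (trans (*-congˡ a≈0) (trans (zeroʳ 1#) (sym (zeroʳ (π ^ l)))))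
    where
    multiple : ∀ k → ∃ λ b → a ≈ π ^ k * b
    multiple k = let (s , (b , s≈b) , x≈) = h k in
      π ^ l * b , lc 1# (cross (begin
            x                           ≈⟨ x≈ ⟩
            KT.nat p KT.^ k *ᵠ s        ≈⟨ embed-π^-* k s ⟨
            embed (π ^ k) *ᵠ s          ≈⟨ K.*-congˡ s≈b ⟩
            embed (π ^ k * b)           ∎))
          (solve 4 (λ P L a b → a := P :* (L :* b) :+ :nat 1 :* (:nat 1 :* a :- L :* (P :* b)))
            refl (π ^ k) (π ^ l) a b)
    a≈0 : a ≈ 0#
    a≈0 = separated a multiple

  embed-+π : ∀ x b → x ≈ᵠ embed b → ∀ c → embed (c + π * b) ≈ᵠ embed c +ᵠ KT.nat p *ᵠ x
  embed-+π x b x≈b c = begin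
    embed (c + π * b)              ≈⟨ embed-+ c (π * b) ⟩
    embed c +ᵠ embed π *ᵠ embed b  ≈⟨ K.+-congˡ (begin
      embed π *ᵠ embed b             ≈⟨ K.*-congˡ x≈b ⟨
      embed π *ᵠ x                   ≈⟨ embed-π-* x ⟩
      KT.nat p *ᵠ x                  ∎) ⟩
    embed c +ᵠ KT.nat p *ᵠ x       ∎

  henselianField : Prime p → HenselianField p
  henselianField pr = record
    { commutativeRing = commutativeRingᵠ
    ; stable    = λ nn → scaled (stable λ ne → nn λ e → ne (unscaled e))
    ; nat≉0     = λ n e → nat≉0 n (embed-injective (K.trans
                    (embed-nat (suc n)) e))
    ; π⁻¹       = 1 , 1#
    ; π*π⁻¹≈1   = begin
        KT.nat p *ᵠ (1 , 1#)   ≈⟨ embed-π-* (1 , 1#) ⟨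
        embed π *ᵠ (1 , 1#)    ≈⟨ fraction-≈ (fraction-* (fraction-embed π) (isFraction (1 , 1#))) (fraction-embed 1#)
                                    (solve 1 (λ p → :nat 1 :* (p :* :nat 1) := (:nat 1 :* (p :* :nat 1)) :* :nat 1) refl π) ⟩
        embed 1#               ∎
    ; Int       = Integral
    ; Int-resp  = λ {x} {y} x≈y (a , x≈a) → a , K.trans (K.sym x≈y) x≈a
    ; Int-1     = 1# , K.refl
    ; Int-+     = λ {x} {y} (a , x≈a) (b , y≈b) → a + b ,
                    K.trans
                      (K.+-cong x≈a y≈b)
                      (K.sym (embed-+ a b))
    ; Int-*     = λ {x} {y} (a , x≈a) (b , y≈b) → a * b , K.*-cong x≈a y≈b
    ; Int-neg   = λ {x} (a , x≈a) → - a , K.-‿cong x≈a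
    ; π-nonunit = λ {s} (b , s≈b) e → π-nonunit b (embed-injective (begin
        embed π *ᵠ embed b     ≈⟨ K.*-congˡ s≈b ⟨
        embed π *ᵠ s           ≈⟨ embed-π-* s ⟩
        KT.nat p *ᵠ s          ≈⟨ e ⟩
        embed 1#               ∎))
    ; valuation = λ x → integral-or-inverse pr (proj₁ x) (proj₂ x)
    ; bounded   = λ x → proj₁ x , bounded-denominator x
    ; separated = separatedᵠ
    ; residue   = residueᵠ
    ; root      = rootᵠ
    }
    where
    residueᵠ : ∀ {x} → Integral x → ∃ λ n → ∃ λ s → Integral s × x ≈ᵠ KT.nat n +ᵠ KT.nat p *ᵠ s
    residueᵠ {x} (a , x≈a) = let (n , _ , b , a≈) = residue a in n , embed b , (b , K.refl) , (begin
      x                                 ≈⟨ x≈a ⟩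
      embed a                           ≈⟨ embed-cong a≈ ⟩
      embed (nat n + π * b)             ≈⟨ embed-+π (embed b) b (K.refl) (nat n) ⟩
      embed (nat n) +ᵠ KT.nat p *ᵠ embed b   ≈⟨ K.+-congʳ (embed-nat n) ⟩
      KT.nat n +ᵠ KT.nat p *ᵠ embed b   ∎)
    rootᵠ : ∀ {x} → Integral x → ∀ k → ∃ λ y → y KT.^ suc (k ℕ.* p) ≈ᵠ embed 1# +ᵠ KT.nat p *ᵠ x
    rootᵠ {x} (a , x≈a) k = let (y , e) = root a k in embed y , (begin
      embed y KT.^ suc (k ℕ.* p)        ≈⟨ embed-^ y (suc (k ℕ.* p)) ⟨
      embed (y ^ suc (k ℕ.* p))         ≈⟨ embed-cong e ⟩
      embed (1# + π * a)                ≈⟨ embed-+π x a x≈a 1# ⟩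
      embed 1# +ᵠ KT.nat p *ᵠ x         ∎)

-- The p-adic case

completeRing : (p : ℕ) .{{_ : NonZero p}} → Prime p → CompleteRing p
completeRing p pr = record
  { commutativeRing = commutativeRing
  ; stable    = stable
  ; nat≉0     = nat≉0
  ; π-nonunit = π-nonunit
  ; π-cancel  = π-cancel
  ; separated = separated
  ; residue   = λ a → _ , Fin.toℕ<n (a 0) , _ , residue a
  ; fixpoint  = fixpoint
  ; scale     = shift p
  ; scale-π^  = shift-π^
  }
  where
  open PAdicIntegers p
  open Nontrivial (ℕ.nonTrivial⇒n>1 p {{prime⇒nonTrivial pr}})

open import Defs

theoremA1 : (p : ℕ) .{{_ : NonZero p}} → Prime p →
    (f : Qp p → Qp p) →
    (∀ x y → _≈_ p x y → _≈_ p (f x) (f y)) →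
    (∀ y → Σ (Qp p) (λ x → _≈_ p (f x) y)) →
    (∀ x y → ¬ _≈_ p x y → ¬ _≈_ p (f x) (f y)) →
    (∀ x y z w → ¬ _≈_ p x y →
    _≡_/_ p z (_+_ p x y) (_-_ p x y) →
    _≡_/_ p w (_+_ p (f x) (f y)) (_-_ p (f x) (f y)) →
    _≈_ p (f z) w) →
    ∀ x → _≈_ p (f x) x
theoremA1 p pr f f-cong _ f-inj f-quot = λ x → unscaled (Rigidity.f-fixes quotientMap x)
  where
  open FractionField (completeRing p pr)
  quotientMap : QuotientMap (henselianField pr)
  quotientMap = record
    { f      = f
    ; f-cong = λ {x} {y} e → scaled (f-cong x y (unscaled e))
    ; f-inj  = λ {x} {y} x≉y e → f-inj x y (λ e′ → x≉y (scaled e′)) (unscaled e)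
    ; f-quot = λ x y z w x≉y ez ew →
        scaled (f-quot x y z w (λ e → x≉y (scaled e)) (unscaled ez) (unscaled ew))
    }
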